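{- For every $n$, the map $\eta:\mathcal S_n\to\mathcal M_n$ is a bijection, and for every $\sigma\in\mathcal S_n$ the path $M=\eta(\sigma)$ satisfies $$\mathrm{wt}(M)= a^{\mathsf{ile}(\sigma)} b^{\mathsf{nile}(\sigma)} c^{\mathsf{ie}(\sigma)-\mathsf{ile}(\sigma)} d^{\mathsf{nie}(\sigma)-\mathsf{nile}(\sigma)} f^{\mathsf{ilae}(\sigma)} g^{\mathsf{nilae}(\sigma)} h^{\mathsf{iae}(\sigma)-\mathsf{ilae}(\sigma)} \ell^{\mathsf{niae}(\sigma)-\mathsf{nilae}(\sigma)}\, p^{\mathsf{exc}(\sigma)-\mathsf{le}(\sigma)} r^{\mathsf{aexc}(\sigma)-\mathsf{lae}(\sigma)} s^{\mathsf{le}(\sigma)} t^{\mathsf{lae}(\sigma)} u^{\mathsf{fp}(\sigma)} w^{\mathsf{iefp}(\sigma)} .$$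
   Context: $[n]=\{1,\dots,n\}$ and $\mathcal S_n$ is the set of permutations of $[n]$. Here $a,b,c,d,f,g,h,\ell,p,r,s,t,u,w$ are commuting indeterminates. Labeled Motzkin paths. A Motzkin path of length $n$ is a lattice path with $n$ steps, each an upstep $(1,1)$, a level step $(1,0)$ or a downstep $(1,-1)$, starting at the origin, ending on the $x$-axis and never going below it. $\mathcal M_n$ is the set of Motzkin paths of length $n$ in which each step carries a label (a monomial) as follows, where $I_k=\{0,1,\dots,k-1\}$: upsteps from height $k-1$ to height $k\ge1$ have labels in $\{p\,c^id^{k-1-i}: i\in I_k\}$; downsteps from height $k$ to height $k-1$ have labels in $\{r\,h^i\ell^{k-1-i}: i\in I_k\}$; level steps at height $k\ge 0$ have labels in $\{u\,w^k\}\cup\{s\,a^ib^{k-1-i}: i\in I_k\}\cup\{t\,f^ig^{k-1-i}: i\in I_k\}$. The weight $\mathrm{wt}(M)$ of $M\in\mathcal M_n$ is the product of its labels. The map $\eta$. Let $\sigma\in\mathcal S_n$, $i\in[n]$. Call $i$ an excedance if $i<\sigma(i)$, an anti-excedance if $i>\sigma(i)$, a fixed point if $i=\sigma(i)$. An excedance $i$ is linked if $\sigma^{ -1}(i)<i$, and an anti-excedance $i$ is linked if $\sigma^{ -1}(i)>i$. Put $\mathsf{inve}_i(\sigma)=\#\{x\in[n]: x<i<\sigma(i)<\sigma(x)\}$, $\mathsf{ninve}_i(\sigma)=\#\{x\in[n]: x<i<\sigma(x)<\sigma(i)\}$, $\mathsf{inva}_i(\sigma)=\#\{x\in[n]: x>i>\sigma(i)>\sigma(x)\}$,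 $\mathsf{ninva}_i(\sigma)=\#\{x\in[n]: x>i>\sigma(x)>\sigma(i)\}$, $\mathsf{iefp}_i(\sigma)=\#\{x\in[n]: x<i<\sigma(x)\}$. The path $\eta(\sigma)$ starts at $(0,0)$ and, for $i=1,\dots,n$, its $i$-th step is: - a level step labeled $a^{\mathsf{inve}_i(\sigma)}b^{\mathsf{ninve}_i(\sigma)}s$ if $i$ is a linked excedance; - an upstep labeled $c^{\mathsf{inve}_i(\sigma)}d^{\mathsf{ninve}_i(\sigma)}p$ if $i$ is a non-linked excedance; - a level step labeled $f^{\mathsf{inva}_i(\sigma)}g^{\mathsf{ninva}_i(\sigma)}t$ if $i$ is a linked anti-excedance; - a downstep labeled $h^{\mathsf{inva}_i(\sigma)}\ell^{\mathsf{ninva}_i(\sigma)}r$ if $i$ is a non-linked anti-excedance; - a level step labeled $u\,w^{\mathsf{iefp}_i(\sigma)}$ if $i$ is a fixed point. Permutation statistics (indices $i$, and ordered pairs $(i,j)$, range over $[n]$): - $\mathsf{exc}(\sigma)=\#\{i: i<\sigma(i)\}$, $\mathsf{fp}(\sigma)=\#\{i:i=\sigma(i)\}$, $\mathsf{aexc}(\sigma)=\#\{i: i>\sigma(i)\}$; - $\mathsf{le}(\sigma)=\#\{i:\sigma^{ -1}(i)<i<\sigma(i)\}$, $\mathsf{lae}(\sigma)=\#\{i:\sigma^{ -1}(i)>i>\sigma(i)\}$; - $\mathsf{ie}(\sigma)=\#\{(i,j): i<j<\sigma(j)<\sigma(i)\}$, $\mathsf{ile}(\sigma)=\#\{(i,j):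 i<j<\sigma(j)<\sigma(i),\ \sigma^{ -1}(j)<j\}$; - $\mathsf{nie}(\sigma)=\#\{(i,j): i<j<\sigma(i)<\sigma(j)\}$, $\mathsf{nile}(\sigma)=\#\{(i,j): i<j<\sigma(i)<\sigma(j),\ \sigma^{ -1}(j)<j\}$; - $\mathsf{iae}(\sigma)=\#\{(i,j): j>i>\sigma(i)>\sigma(j)\}$, $\mathsf{ilae}(\sigma)=\#\{(i,j): j>i>\sigma(i)>\sigma(j),\ \sigma^{ -1}(i)>i\}$; - $\mathsf{niae}(\sigma)=\#\{(i,j): j>i>\sigma(j)>\sigma(i)\}$, $\mathsf{nilae}(\sigma)=\#\{(i,j): j>i>\sigma(j)>\sigma(i),\ \sigma^{ -1}(i)>i\}$; - $\mathsf{iefp}(\sigma)=\#\{(i,j): i<j=\sigma(j)<\sigma(i)\}$. -}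

module Defs where

open import Data.Bool using (if_then_else_)
open import Data.Fin using (Fin; toℕ; #_)
open import Data.Fin.Permutation using (Permutation′)
open import Data.Fin.Properties using (_≟_; _<?_; <-cmp)
open import Data.List using (allFin; cartesianProduct; filter; length)
open import Data.Nat using (ℕ; suc; _+_; _*_; _∸_)
open import Data.Product using (_×_; _,_; proj₁; proj₂; uncurry; Σ-syntax)
open import Data.Sum using (_⊎_)
open import Data.Vec using (Vec; []; _∷_; map; zipWith; replicate; foldr′; tabulate; _[_]≔_)
open import Function.Bundles using (module Inverse)
open import Level using (0ℓ)
open import Relation.Binary.Core using (Rel)
open import Relation.Binary.Definitions using (tri<; tri≈; tri>) renaming (Decidable to Decidable₂)
open import Relation.Binary.PropositionalEquality using (_≡_)
open import Relation.Nullary using (does)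
open import Relation.Nullary.Decidable using (_×-dec_)
open import Relation.Unary using (Pred; Decidable; _∈_)

-- Monomials in the 14 commuting indeterminates, as exponent vectors.

Monomial : Set
Monomial = Vec ℕ 14

infixl 7 _·_
infixr 8 _^_

_·_ : Monomial → Monomial → Monomial
_·_ = zipWith _+_

ε : Monomial
ε = replicate 14 0

_^_ : Monomial → ℕ → Monomial
m ^ k = map (k *_) m

indeterminate : Fin 14 → Monomial
indeterminate x = ε [ x ]≔ 1

a b c d f g h ℓ p r s t u w : Monomial
a = indeterminate (# 0)
b = indeterminate (# 1)
c = indeterminate (# 2)
d = indeterminate (# 3)
f = indeterminate (# 4)
g = indeterminate (# 5)
h = indeterminate (# 6)
ℓ = indeterminate (# 7)
p = indeterminate (# 8)
r = indeterminate (# 9)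
s = indeterminate (# 10)
t = indeterminate (# 11)
u = indeterminate (# 12)
w = indeterminate (# 13)

data Direction : Set where
  up level down : Direction

LabeledStep : Set
LabeledStep = Direction × Monomial

-- The argument k of upLabels and downLabels is the larger of the two
-- heights joined by the step; Fin k plays the role of I_k = {0, …, k-1}.

upLabels : ℕ → Pred Monomial 0ℓ
upLabels k m = Σ[ i ∈ Fin k ] m ≡ p · c ^ toℕ i · d ^ (k ∸ 1 ∸ toℕ i)

downLabels : ℕ → Pred Monomial 0ℓ
downLabels k m = Σ[ i ∈ Fin k ] m ≡ r · h ^ toℕ i · ℓ ^ (k ∸ 1 ∸ toℕ i)

levelLabels : ℕ → Pred Monomial 0ℓ
levelLabels k m =
    m ≡ u · w ^ k
  ⊎ (Σ[ i ∈ Fin k ] m ≡ s · a ^ toℕ i · b ^ (k ∸ 1 ∸ toℕ i))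
  ⊎ (Σ[ i ∈ Fin k ] m ≡ t · f ^ toℕ i · g ^ (k ∸ 1 ∸ toℕ i))

-- MotzkinFrom k M: the labeled steps M, started at height k, never go
-- below height 0, end at height 0, and carry admissible labels.

data MotzkinFrom : ℕ → ∀ {n} → Vec LabeledStep n → Set where
  []     : MotzkinFrom 0 []
  up∷    : ∀ {k n m} {M : Vec LabeledStep n} → m ∈ upLabels (suc k) →
           MotzkinFrom (suc k) M → MotzkinFrom k ((up , m) ∷ M)
  level∷ : ∀ {k n m} {M : Vec LabeledStep n} → m ∈ levelLabels k →
           MotzkinFrom k M → MotzkinFrom k ((level , m) ∷ M)
  down∷  : ∀ {k n m} {M : Vec LabeledStep n} → m ∈ downLabels (suc k) →
           MotzkinFrom k M → MotzkinFrom (suc k) ((down , m) ∷ M)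

ℳ : ℕ → Set
ℳ n = Σ[ M ∈ Vec LabeledStep n ] MotzkinFrom 0 M

-- Paths are equal when their labeled steps are; the proof component is
-- irrelevant.

infix 4 _≈ₘ_

_≈ₘ_ : ∀ {n} → Rel (ℳ n) 0ℓ
M ≈ₘ N = proj₁ M ≡ proj₁ N

wt : ∀ {n} → ℳ n → Monomial
wt (M , _) = foldr′ _·_ ε (map proj₂ M)

count : ∀ {n} {P : Pred (Fin n) 0ℓ} → Decidable P → ℕ
count {n} P? = length (filter P? (allFin n))

count₂ : ∀ {n} {P : Rel (Fin n) 0ℓ} → Decidable₂ P → ℕ
count₂ {n} P? = length (filter (uncurry P?) (cartesianProduct (allFin n) (allFin n)))

module _ {n : ℕ} (π : Permutation′ n) where

  open Inverse π using () renaming (to to σ; from to σ⁻¹)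

  inveᵢ ninveᵢ invaᵢ ninvaᵢ iefpᵢ : Fin n → ℕ
  inveᵢ  i = count λ x → x <? i ×-dec i <? σ i ×-dec σ i <? σ x
  ninveᵢ i = count λ x → x <? i ×-dec i <? σ x ×-dec σ x <? σ i
  invaᵢ  i = count λ x → i <? x ×-dec σ i <? i ×-dec σ x <? σ i
  ninvaᵢ i = count λ x → i <? x ×-dec σ x <? i ×-dec σ i <? σ x
  iefpᵢ  i = count λ x → x <? i ×-dec i <? σ x

  ηStep : Fin n → LabeledStep
  ηStep i with <-cmp i (σ i)
  ... | tri< _ _ _ = if does (σ⁻¹ i <? i)
    then (level , a ^ inveᵢ i · b ^ ninveᵢ i · s)
    else (up    , c ^ inveᵢ i · d ^ ninveᵢ i · p)
  ... | tri≈ _ _ _ = level , u · w ^ iefpᵢ i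
  ... | tri> _ _ _ = if does (i <? σ⁻¹ i)
    then (level , f ^ invaᵢ i · g ^ ninvaᵢ i · t)
    else (down  , h ^ invaᵢ i · ℓ ^ ninvaᵢ i · r)

  ηSteps : Vec LabeledStep n
  ηSteps = tabulate ηStep

  exc fp aexc le lae : ℕ
  exc  = count λ i → i <? σ i
  fp   = count λ i → i ≟ σ i
  aexc = count λ i → σ i <? i
  le   = count λ i → σ⁻¹ i <? i ×-dec i <? σ i
  lae  = count λ i → i <? σ⁻¹ i ×-dec σ i <? i

  ie ile nie nile iae ilae niae nilae iefp : ℕ
  ie    = count₂ λ i j → i <? j ×-dec j <? σ j ×-dec σ j <? σ i
  ile   = count₂ λ i j → (i <? j ×-dec j <? σ j ×-dec σ j <? σ i) ×-dec σ⁻¹ j <? j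
  nie   = count₂ λ i j → i <? j ×-dec j <? σ i ×-dec σ i <? σ j
  nile  = count₂ λ i j → (i <? j ×-dec j <? σ i ×-dec σ i <? σ j) ×-dec σ⁻¹ j <? j
  iae   = count₂ λ i j → i <? j ×-dec σ i <? i ×-dec σ j <? σ i
  ilae  = count₂ λ i j → (i <? j ×-dec σ i <? i ×-dec σ j <? σ i) ×-dec i <? σ⁻¹ i
  niae  = count₂ λ i j → i <? j ×-dec σ j <? i ×-dec σ i <? σ j
  nilae = count₂ λ i j → (i <? j ×-dec σ j <? i ×-dec σ i <? σ j) ×-dec i <? σ⁻¹ i
  iefp  = count₂ λ i j → i <? j ×-dec j ≟ σ j ×-dec σ j <? σ i

{-# OPTIONS --safe #-}
module Submission where

-- The number k of x < i with σ(x) ≥ i is the height of η(σ) before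
-- step i, and the two exponents of the label of step i sum to k or k - 1; this
-- bounds them as required, and it makes the second exponent redundant.  Read
-- from left to right, inva_i is the rank of σ(i) among the values below i that
-- are still available, so the kinds of the steps together with the inva_i
-- determine the anti-excedances.  Reversing the order of [n] exchanges
-- excedances with anti-excedances and inve with inva, so the same holds for the
-- excedances, and η is injective.  For surjectivity, a stack algorithm produces
-- a permutation whose steps have the kinds prescribed by the path.  Going
-- through the positions from left to right, one then gives each anti-excedance
-- the prescribed inva_i by exchanging two anti-excedance values, and
-- from right to left one does the same for the excedances; neither pass
-- affects the kinds or the result of the other.

-- Why the sums are `k` or `k - 1`: before step i, k earlier positions have an image at least i.
-- Since a permutation moves as many positions out of an initial segment as into it, exactly k
-- values below i still lack a preimage. At a non-linked excedance all k positions pass over i; at a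
-- linked one σ⁻¹(i) lands on i itself, so k - 1 pass over it. An anti-excedance takes one of the k
-- open values, and the exponents compare that value with the other k - 1. Why the passes do not
-- interfere: any x counted in inva_i satisfies σ(x) < σ(i) < i < x, so it is an anti-excedance as
-- well. Hence inva_i at an anti-excedance depends on the anti-excedances alone, and dually for
-- inve_i. The second exponents have no such locality in their definition; they are recovered from
-- the heights instead, and the heights depend only on the kinds of the steps.

open import Data.Bool using (Bool; true; false; if_then_else_)
open import Data.Fin as Fin using (Fin; zero; suc; toℕ; fromℕ<; opposite; #_)
open import Data.Fin.Induction using (Acc; acc; spo-wellFounded)
open import Data.Fin.Permutation
  using (Permutation′; _≈_; _⟨$⟩ʳ_; _⟨$⟩ˡ_; inverseˡ; inverseʳ; transpose; _∘ₚ_)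
  renaming (id to idₚ)
import Data.Fin.Properties as Fin
open import Data.List as List using ([]; _∷_; filter; length; cartesianProduct)
import Data.List.Membership.Propositional as List
open import Data.List.Membership.Propositional.Properties using (∈-allFin; ∈-tabulate⁺)
import Data.List.Properties as List
import Data.List.Relation.Unary.All as ListAll
import Data.List.Relation.Unary.AllPairs as ListAllPairs
open import Data.List.Relation.Unary.AllPairs using ([]; _∷_)
import Data.List.Relation.Unary.AllPairs.Properties as ListAllPairs
open import Data.List.Relation.Unary.Any using (here; there)
open import Data.Nat as ℕ using (ℕ; zero; suc; _+_; _∸_; _≤_; _<_; _≤?_; _<?_)
open import Data.Nat.GeneralisedArithmetic using (fold)
import Data.Nat.Properties as ℕ
open import Data.Product using (_×_; _,_; proj₁; proj₂; uncurry; Σ-syntax; ∃-syntax)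
open import Data.Sum using (_⊎_; inj₁; inj₂)
open import Data.Vec as Vec using (Vec; []; _∷_; lookup; tabulate)
import Data.Vec.Membership.DecPropositional as DecMembership
open import Data.Vec.Membership.Propositional using (_∈_; _∉_)
import Data.Vec.Properties as Vec
open import Data.Vec.Relation.Unary.All as VecAll using ([]; _∷_)
open import Data.Vec.Relation.Unary.AllPairs using ([]; _∷_)
open import Data.Vec.Relation.Unary.Any using (here; there)
open import Data.Vec.Relation.Unary.Unique.Propositional using (Unique)
open import Function using (_∘_; id; flip)
open import Function.Structures using (IsBijection)
open import Level using (0ℓ)
open import Relation.Binary.Core using (Rel)
import Relation.Binary.Construct.Flip.EqAndOrd as Flip
open import Relation.Binary.Definitions using (tri<; tri≈; tri>) renaming (Decidable to Decidable₂)
open import Relation.Binary.PropositionalEquality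
open import Relation.Binary.Structures using (IsStrictTotalOrder)
open import Relation.Nullary using (¬_; Dec; yes; no; does)
open import Relation.Nullary.Decidable using (_×-dec_; ¬?; dec-true; dec-false)
open import Relation.Nullary.Negation using (contradiction)
open import Relation.Unary using (Pred; Decidable; _⊆_)
open import Defs
open import Algebra.Properties.CommutativeMonoid.Sum ℕ.+-0-commutativeMonoid
  using (sum; sum-cong-≗; sum-permute; ∑-comm; ∑-distrib-+)

-- Counting over `Fin n`

indicator : ∀ {P : Set} → Dec P → ℕ
indicator P? = if does P? then 1 else 0

length-filter-tabulate : ∀ {A : Set} {P : Pred A 0ℓ} (P? : Decidable P) {n} (f : Fin n → A) →
  length (filter P? (List.tabulate f)) ≡ sum (λ i → indicator (P? (f i)))
length-filter-tabulate P? {zero} f = refl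
length-filter-tabulate P? {suc n} f with does (P? (f zero))
... | true  = cong suc (length-filter-tabulate P? (f ∘ suc))
... | false = length-filter-tabulate P? (f ∘ suc)

module _ {n : ℕ} where

  count≡sum : {P : Pred (Fin n) 0ℓ} (P? : Decidable P) → count P? ≡ sum (λ i → indicator (P? i))
  count≡sum P? = length-filter-tabulate P? id

  count-cong : {P Q : Pred (Fin n) 0ℓ} (P? : Decidable P) (Q? : Decidable Q) →
    P ⊆ Q → Q ⊆ P → count P? ≡ count Q?
  count-cong P? Q? P⊆Q Q⊆P = cong length (List.filter-≐ P? Q? (P⊆Q , Q⊆P) (List.allFin n))

  count-permute : {P : Pred (Fin n) 0ℓ} (P? : Decidable P) (π : Permutation′ n) →
    count P? ≡ count (λ i → P? (π ⟨$⟩ʳ i))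
  count-permute P? π = begin
    count P?                              ≡⟨ count≡sum P? ⟩
    sum (λ i → indicator (P? i))          ≡⟨ sum-permute (λ i → indicator (P? i)) π ⟩
    sum (λ i → indicator (P? (π ⟨$⟩ʳ i))) ≡⟨ count≡sum (λ i → P? (π ⟨$⟩ʳ i)) ⟨
    count (λ i → P? (π ⟨$⟩ʳ i))           ∎
    where open ≡-Reasoning

  count-⊎ : {P Q R : Pred (Fin n) 0ℓ} (P? : Decidable P) (Q? : Decidable Q) (R? : Decidable R) →
    Q ⊆ P → R ⊆ P → (∀ {x} → P x → Q x ⊎ R x) → (∀ {x} → Q x → ¬ R x) →
    count P? ≡ count Q? + count R?
  count-⊎ P? Q? R? Q⊆P R⊆P P⊆Q⊎R Q∩R=∅ = begin
    count P?                                          ≡⟨ count≡sum P? ⟩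
    sum (λ i → indicator (P? i))                      ≡⟨ sum-cong-≗ pointwise ⟩
    sum (λ i → indicator (Q? i) + indicator (R? i))   ≡⟨ ∑-distrib-+ (λ i → indicator (Q? i)) (λ i → indicator (R? i)) ⟩
    sum (λ i → indicator (Q? i)) + sum (λ i → indicator (R? i))
      ≡⟨ cong₂ _+_ (count≡sum Q?) (count≡sum R?) ⟨
    count Q? + count R?                               ∎
    where
    open ≡-Reasoning
    pointwise : ∀ i → indicator (P? i) ≡ indicator (Q? i) + indicator (R? i)
    pointwise i with P? i | Q? i | R? i
    ... | _      | yes q  | yes r = contradiction r (Q∩R=∅ q)
    ... | yes _  | yes _  | no _  = refl
    ... | yes _  | no _   | yes _ = refl
    ... | yes Pi | no ¬q  | no ¬r with P⊆Q⊎R Pi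
    ...   | inj₁ q = contradiction q ¬q
    ...   | inj₂ r = contradiction r ¬r
    pointwise i | no ¬p | yes q | no _  = contradiction (Q⊆P q) ¬p
    pointwise i | no ¬p | no _  | yes r = contradiction (R⊆P r) ¬p
    pointwise i | no _  | no _  | no _  = refl

  -- An empty `P` is the disjoint union of two copies of itself, so its count equals its own double
  -- and cancels to `0`.
  count-∅ : {P : Pred (Fin n) 0ℓ} (P? : Decidable P) → (∀ {x} → ¬ P x) → count P? ≡ 0
  count-∅ P? ¬P = ℕ.+-cancelˡ-≡ (count P?) (count P?) 0 (trans
    (sym (count-⊎ P? P? P? id id inj₁ (λ p → contradiction p ¬P))) (sym (ℕ.+-identityʳ _)))

  count-singleton : {P : Pred (Fin n) 0ℓ} (P? : Decidable P) (i : Fin n) →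
    P i → (∀ {x} → P x → x ≡ i) → count P? ≡ 1
  count-singleton P? i Pi unique = begin
    count P?                      ≡⟨ count-cong P? (Fin._≟ i) unique (λ { refl → Pi }) ⟩
    count (Fin._≟ i)              ≡⟨ count≡sum (Fin._≟ i) ⟩
    sum (λ x → indicator (x Fin.≟ i)) ≡⟨ diag i ⟩
    1                             ∎
    where
    open ≡-Reasoning
    zeros : ∀ m → sum {m} (λ _ → 0) ≡ 0
    zeros zero = refl
    zeros (suc m) = zeros m
    diag : ∀ {m} (i : Fin m) → sum (λ x → indicator (x Fin.≟ i)) ≡ 1
    diag {suc m} zero = cong suc (zeros m)
    diag (suc i) = diag i

  count-insert : {P Q : Pred (Fin n) 0ℓ} (P? : Decidable P) (Q? : Decidable Q) (i : Fin n) →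
    Q ⊆ P → P i → ¬ Q i → (∀ {x} → P x → x ≡ i ⊎ Q x) → count P? ≡ suc (count Q?)
  count-insert P? Q? i Q⊆P Pi ¬Qi split = trans
    (count-⊎ P? (Fin._≟ i) Q? (λ { refl → Pi }) Q⊆P split (λ { refl → ¬Qi }))
    (cong (_+ count Q?) (count-singleton (Fin._≟ i) i refl id))

  count-positive : {P : Pred (Fin n) 0ℓ} (P? : Decidable P) {i : Fin n} → P i → 0 < count P?
  count-positive {P} P? {i} Pi = subst (0 <_)
    (sym (count-insert P? (λ x → P? x ×-dec ¬? (x Fin.≟ i)) i proj₁ Pi (λ z → proj₂ z refl) split))
    (ℕ.z<s)
    where
    split : ∀ {x} → P x → x ≡ i ⊎ (P x × x ≢ i)
    split {x} Px with x Fin.≟ i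
    ... | yes x≡i = inj₁ x≡i
    ... | no  x≢i = inj₂ (Px , x≢i)

  count-< : {P Q : Pred (Fin n) 0ℓ} (P? : Decidable P) (Q? : Decidable Q) (i : Fin n) →
    Q ⊆ P → P i → ¬ Q i → count Q? < count P?
  count-< {P} {Q} P? Q? i Q⊆P Pi ¬Qi = subst (count Q? <_)
    (sym (count-⊎ P? Q? rest? Q⊆P proj₁ split (λ q → λ (_ , ¬q) → ¬q q)))
    (ℕ.m<m+n (count Q?) (count-positive rest? (Pi , ¬Qi)))
    where
    rest? = λ x → P? x ×-dec ¬? (Q? x)
    split : ∀ {x} → P x → Q x ⊎ (P x × ¬ Q x)
    split {x} Px with Q? x
    ... | yes q = inj₁ q
    ... | no ¬q = inj₂ (Px , ¬q)

  -- Linkedness and being fixed concern a single index of a pair. Summing over the other index turns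
  -- such a condition into a switch on a whole row of the count.
  count-×-const : {P : Pred (Fin n) 0ℓ} {Q : Set} (P? : Decidable P) (Q? : Dec Q) →
    count (λ x → P? x ×-dec Q?) ≡ (if does Q? then count P? else 0)
  count-×-const P? (yes q) = count-cong _ P? proj₁ (_, q)
  count-×-const P? (no ¬q) = count-∅ _ (¬q ∘ proj₂)

  count₂≡sum : {P : Rel (Fin n) 0ℓ} (P? : Decidable₂ P) → count₂ P? ≡ sum (λ i → count (P? i))
  count₂≡sum {P} P? = go id
    where
    open ≡-Reasoning
    row : ∀ x ys → length (filter (uncurry P?) (List.map (x ,_) ys)) ≡ length (filter (P? x) ys)
    row x [] = refl
    row x (y ∷ ys) with does (P? x y)
    ... | true = cong suc (row x ys)
    ... | false = row x ys
    go : ∀ {m} (f : Fin m → Fin n) →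
      length (filter (uncurry P?) (cartesianProduct (List.tabulate f) (List.allFin n))) ≡
      sum (λ i → count (P? (f i)))
    go {zero} f = refl
    go {suc m} f = begin
      length (filter (uncurry P?) (List.map (f zero ,_) (List.allFin n) List.++ rest))
        ≡⟨ cong length (List.filter-++ (uncurry P?) (List.map (f zero ,_) (List.allFin n)) rest) ⟩
      length (filter (uncurry P?) (List.map (f zero ,_) (List.allFin n)) List.++ filter (uncurry P?) rest)
        ≡⟨ List.length-++ (filter (uncurry P?) (List.map (f zero ,_) (List.allFin n))) ⟩
      length (filter (uncurry P?) (List.map (f zero ,_) (List.allFin n))) + length (filter (uncurry P?) rest)
        ≡⟨ cong₂ _+_ (row (f zero) (List.allFin n)) (go (f ∘ suc)) ⟩
      count (P? (f zero)) + sum (λ i → count (P? (f (suc i)))) ∎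
      where rest = cartesianProduct (List.tabulate (f ∘ suc)) (List.allFin n)

  -- The excedance statistics and `iefp` are grouped by the second index of a pair, the
  -- anti-excedance statistics by the first; this is the former grouping.
  count₂≡sumᵒ : {P : Rel (Fin n) 0ℓ} (P? : Decidable₂ P) →
    count₂ P? ≡ sum (λ j → count (λ i → P? i j))
  count₂≡sumᵒ P? = begin
    count₂ P?                                        ≡⟨ count₂≡sum P? ⟩
    sum (λ i → count (P? i))                         ≡⟨ sum-cong-≗ (λ i → count≡sum (P? i)) ⟩
    sum (λ i → sum (λ j → indicator (P? i j)))       ≡⟨ ∑-comm (λ i j → indicator (P? i j)) ⟩
    sum (λ j → sum (λ i → indicator (P? i j)))       ≡⟨ sum-cong-≗ (λ j → count≡sum (λ i → P? i j)) ⟨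
    sum (λ j → count (λ i → P? i j))                 ∎
    where open ≡-Reasoning

-- Inverses and transpositions

⟨$⟩ˡ-unique : ∀ {n} (π : Permutation′ n) {x y} → π ⟨$⟩ʳ x ≡ y → π ⟨$⟩ˡ y ≡ x
⟨$⟩ˡ-unique π refl = inverseˡ π

⟨$⟩ʳ-unique : ∀ {n} (π : Permutation′ n) {x y} → π ⟨$⟩ˡ y ≡ x → π ⟨$⟩ʳ x ≡ y
⟨$⟩ʳ-unique π refl = inverseʳ π

transpose-ˡ : ∀ {n} (i j : Fin n) → transpose i j ⟨$⟩ʳ i ≡ j
transpose-ˡ i j rewrite dec-true (i Fin.≟ i) refl = refl

transpose-ʳ : ∀ {n} (i j : Fin n) → transpose i j ⟨$⟩ʳ j ≡ i
transpose-ʳ i j with j Fin.≟ i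
... | yes j≡i = j≡i
... | no  _ rewrite dec-true (j Fin.≟ j) refl = refl

transpose-≢ : ∀ {n} {i j k : Fin n} → k ≢ i → k ≢ j → transpose i j ⟨$⟩ʳ k ≡ k
transpose-≢ {i = i} {j} {k} k≢i k≢j
  rewrite dec-false (k Fin.≟ i) k≢i | dec-false (k Fin.≟ j) k≢j = refl

-- Descents, available values and ranks for a strict total order

-- For ≺ = < the descents of π are its anti-excedances, and nest and cross are
-- the statistics invaᵢ and ninvaᵢ; for ≺ = > they are its excedances, and nest,
-- cross and span are inveᵢ, ninveᵢ and iefpᵢ, definitionally.
module Descents {n : ℕ} {_≺_ : Rel (Fin n) 0ℓ}
  (≺-isStrictTotalOrder : IsStrictTotalOrder _≡_ _≺_) (_≺?_ : Decidable₂ _≺_) where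

  open IsStrictTotalOrder ≺-isStrictTotalOrder
    using (isStrictPartialOrder; compare; irrefl; asym) renaming (trans to ≺-trans)

  ≺-wellFounded = spo-wellFounded isStrictPartialOrder

  ≺-⊀-trans : ∀ {x y z} → x ≺ y → ¬ z ≺ y → x ≺ z
  ≺-⊀-trans {x} {y} {z} x≺y z⊀y with compare z y
  ... | tri< z≺y _ _ = contradiction z≺y z⊀y
  ... | tri≈ _ refl _ = x≺y
  ... | tri> _ _ y≺z = ≺-trans x≺y y≺z

  minimum : {P : Pred (Fin n) 0ℓ} (P? : Decidable P) → 0 < count P? →
    ∃[ i ] P i × (∀ {j} → P j → ¬ j ≺ i)
  minimum {P} P? positive with Fin.any? P?
  ... | no none = contradiction (subst (0 <_) (count-∅ P? (λ Px → none (_ , Px))) positive) λ ()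
  ... | yes (i , Pi) = descend Pi (≺-wellFounded i)
    where
    descend : ∀ {i} → P i → Acc _≺_ i → ∃[ i ] P i × (∀ {j} → P j → ¬ j ≺ i)
    descend {i} Pi (acc rec) with Fin.any? (λ j → P? j ×-dec j ≺? i)
    ... | yes (j , Pj , j≺i) = descend Pj (rec j≺i)
    ... | no none = i , Pi , λ Pj j≺i → none (_ , Pj , j≺i)

  select : ∀ k {P : Pred (Fin n) 0ℓ} (P? : Decidable P) → k < count P? →
    ∃[ i ] P i × count (λ j → P? j ×-dec j ≺? i) ≡ k
  select k {P} P? k<count with minimum P? (ℕ.≤-<-trans ℕ.z≤n k<count)
  select zero    P? k<count | m , Pm , m-min =
    m , Pm , count-∅ (λ j → P? j ×-dec j ≺? m) λ (Pj , j≺m) → m-min Pj j≺m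
  select (suc k) {P} P? k<count | m , Pm , m-min
    -- With the minimum `m` set aside, the element of rank `k` among the remaining elements of `P`
    -- has rank `suc k` in `P`.
    with select k (λ j → P? j ×-dec m ≺? j)
           (ℕ.s<s⁻¹ (subst (suc k <_)
             (count-insert P? (λ j → P? j ×-dec m ≺? j) m proj₁ Pm (irrefl refl ∘ proj₂) split) k<count))
    where
    split : ∀ {j} → P j → j ≡ m ⊎ (P j × m ≺ j)
    split {j} Pj with compare j m
    ... | tri< j≺m _ _ = contradiction j≺m (m-min Pj)
    ... | tri≈ _ j≡m _ = inj₁ j≡m
    ... | tri> _ _ m≺j = inj₂ (Pj , m≺j)
  ... | i , (Pi , m≺i) , count≡k = i , Pi , trans
    (count-insert (λ j → P? j ×-dec j ≺? i) (λ j → (P? j ×-dec m ≺? j) ×-dec j ≺? i) m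
      (λ ((Pj , _) , j≺i) → Pj , j≺i) (Pm , m≺i) (irrefl refl ∘ proj₂ ∘ proj₁) split)
    (cong suc count≡k)
    where
    split : ∀ {j} → P j × j ≺ i → j ≡ m ⊎ ((P j × m ≺ j) × j ≺ i)
    split {j} (Pj , j≺i) with compare j m
    ... | tri< j≺m _ _ = contradiction j≺m (m-min Pj)
    ... | tri≈ _ j≡m _ = inj₁ j≡m
    ... | tri> _ _ m≺j = inj₂ ((Pj , m≺j) , j≺i)

  -- `Available π i` collects the values below `i` that no position before `i` takes. `Landing π i`
  -- is the same set seen through the preimages; it differs from `Spanning π i` only in that it
  -- admits `i` itself.
  Nesting Crossing Spanning Available Landing : Permutation′ n → Fin n → Pred (Fin n) 0ℓ
  Nesting   π i x = i ≺ x × (π ⟨$⟩ʳ i) ≺ i × (π ⟨$⟩ʳ x) ≺ (π ⟨$⟩ʳ i)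
  Crossing  π i x = i ≺ x × (π ⟨$⟩ʳ x) ≺ i × (π ⟨$⟩ʳ i) ≺ (π ⟨$⟩ʳ x)
  Spanning  π i x = i ≺ x × (π ⟨$⟩ʳ x) ≺ i
  Available π i y = y ≺ i × ¬ (π ⟨$⟩ˡ y) ≺ i
  Landing   π i x = (π ⟨$⟩ʳ x) ≺ i × ¬ x ≺ i

  nesting?   : ∀ π i → Decidable (Nesting π i)
  nesting?   π i x = i ≺? x ×-dec (π ⟨$⟩ʳ i) ≺? i ×-dec (π ⟨$⟩ʳ x) ≺? (π ⟨$⟩ʳ i)

  crossing?  : ∀ π i → Decidable (Crossing π i)
  crossing?  π i x = i ≺? x ×-dec (π ⟨$⟩ʳ x) ≺? i ×-dec (π ⟨$⟩ʳ i) ≺? (π ⟨$⟩ʳ x)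

  spanning?  : ∀ π i → Decidable (Spanning π i)
  spanning?  π i x = i ≺? x ×-dec (π ⟨$⟩ʳ x) ≺? i

  available? : ∀ π i → Decidable (Available π i)
  available? π i y = y ≺? i ×-dec ¬? ((π ⟨$⟩ˡ y) ≺? i)

  landing?   : ∀ π i → Decidable (Landing π i)
  landing?   π i x = (π ⟨$⟩ʳ x) ≺? i ×-dec ¬? (x ≺? i)

  nest cross span : Permutation′ n → Fin n → ℕ
  nest  π i = count (nesting? π i)
  cross π i = count (crossing? π i)
  span  π i = count (spanning? π i)

  below? : ∀ π i y → Decidable (λ z → Available π i z × z ≺ y)
  below? π i y z = available? π i z ×-dec z ≺? y

  nest+cross : ∀ π {i} → (π ⟨$⟩ʳ i) ≺ i → span π i ≡ nest π i + cross π i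
  nest+cross π {i} πi≺i = count-⊎ (spanning? π i) (nesting? π i) (crossing? π i)
    (λ (i≺x , _ , πx≺πi) → i≺x , ≺-trans πx≺πi πi≺i)
    (λ (i≺x , πx≺i , _) → i≺x , πx≺i)
    split
    (λ (_ , _ , πx≺πi) (_ , _ , πi≺πx) → asym πx≺πi πi≺πx)
    where
    split : ∀ {x} → Spanning π i x → Nesting π i x ⊎ Crossing π i x
    split {x} (i≺x , πx≺i) with compare (π ⟨$⟩ʳ x) (π ⟨$⟩ʳ i)
    ... | tri< πx≺πi _ _ = inj₁ (i≺x , πi≺i , πx≺πi)
    ... | tri> _ _ πi≺πx = inj₂ (i≺x , πx≺i , πi≺πx)
    ... | tri≈ _ πx≡πi _ = contradiction i≺x (irrefl
      (trans (sym (inverseˡ π)) (trans (cong (π ⟨$⟩ˡ_) (sym πx≡πi)) (inverseˡ π))))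

  nest-∅ : ∀ π {i} → ¬ (π ⟨$⟩ʳ i) ≺ i → nest π i ≡ 0
  nest-∅ π {i} πi⊀i = count-∅ (nesting? π i) λ (_ , πi≺i , _) → πi⊀i πi≺i

  cross-∅ : ∀ π {i} → ¬ (π ⟨$⟩ʳ i) ≺ i → cross π i ≡ 0
  cross-∅ π {i} πi⊀i = count-∅ (crossing? π i) λ (_ , πx≺i , πi≺πx) → πi⊀i (≺-trans πi≺πx πx≺i)

  count-available : ∀ π i →
    count (available? π i) ≡ count (landing? π i)
  count-available π i = trans (count-permute (available? π i) π)
    (count-cong (λ x → available? π i (π ⟨$⟩ʳ x)) (landing? π i)
    (λ (πx≺i , x⊀i) → πx≺i , x⊀i ∘ subst (_≺ i) (sym (inverseˡ π)))
    (λ (πx≺i , x⊀i) → πx≺i , x⊀i ∘ subst (_≺ i) (inverseˡ π)))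

  -- The extra `1` is `i` itself, which lands below `i` but does not span it.
  count-available-descent : ∀ π {i} → (π ⟨$⟩ʳ i) ≺ i → count (available? π i) ≡ suc (span π i)
  count-available-descent π {i} πi≺i = trans (count-available π i)
    (count-insert (landing? π i) (spanning? π i) i
    (λ (i≺x , πx≺i) → πx≺i , asym i≺x) (πi≺i , irrefl refl) (irrefl refl ∘ proj₁) split)
    where
    split : ∀ {x} → Landing π i x → x ≡ i ⊎ Spanning π i x
    split {x} (πx≺i , x⊀i) with compare x i
    ... | tri< x≺i _ _ = contradiction x≺i x⊀i
    ... | tri≈ _ x≡i _ = inj₁ x≡i
    ... | tri> _ _ i≺x = inj₂ (i≺x , πx≺i)

  -- This is the rank interpretation of `nest`: the positions nested with `i` correspond under `π`
  -- to the available values smaller than the image of `i`.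
  nest-available : ∀ π {i} → (π ⟨$⟩ʳ i) ≺ i →
    nest π i ≡ count (below? π i (π ⟨$⟩ʳ i))
  nest-available π {i} πi≺i = sym (trans
    (count-permute (below? π i (π ⟨$⟩ʳ i)) π)
    (count-cong (λ x → below? π i (π ⟨$⟩ʳ i) (π ⟨$⟩ʳ x)) (nesting? π i) to from))
    where
    to : ∀ {x} → ((π ⟨$⟩ʳ x) ≺ i × ¬ (π ⟨$⟩ˡ (π ⟨$⟩ʳ x)) ≺ i) × (π ⟨$⟩ʳ x) ≺ (π ⟨$⟩ʳ i) →
      Nesting π i x
    to {x} ((_ , x⊀i) , πx≺πi) with compare i x
    ... | tri< i≺x _ _ = i≺x , πi≺i , πx≺πi
    ... | tri≈ _ i≡x _ = contradiction πx≺πi (irrefl (cong (π ⟨$⟩ʳ_) (sym i≡x)))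
    ... | tri> _ _ x≺i = contradiction (subst (_≺ i) (sym (inverseˡ π)) x≺i) x⊀i
    from : ∀ {x} → Nesting π i x →
      ((π ⟨$⟩ʳ x) ≺ i × ¬ (π ⟨$⟩ˡ (π ⟨$⟩ʳ x)) ≺ i) × (π ⟨$⟩ʳ x) ≺ (π ⟨$⟩ʳ i)
    from (i≺x , _ , πx≺πi) =
      (≺-trans πx≺πi πi≺i , asym i≺x ∘ subst (_≺ i) (inverseˡ π)) , πx≺πi

  -- If `x` is nested with the descent `i`, then σx ≺ σi ≺ i ≺ x, so `x` is a descent too and
  -- agreement at descents is enough. This is what protects the result of the first pass from the
  -- second.
  nest-cong : ∀ {σ τ} → (∀ {x} → (σ ⟨$⟩ʳ x) ≺ x → σ ⟨$⟩ʳ x ≡ τ ⟨$⟩ʳ x) →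
    (∀ {x} → (τ ⟨$⟩ʳ x) ≺ x → σ ⟨$⟩ʳ x ≡ τ ⟨$⟩ʳ x) → ∀ i → nest σ i ≡ nest τ i
  nest-cong {σ} {τ} onσ onτ i = count-cong (nesting? σ i) (nesting? τ i)
    (transfer {σ} {τ} onσ) (transfer {τ} {σ} (sym ∘ onτ))
    where
    transfer : ∀ {σ τ} → (∀ {x} → (σ ⟨$⟩ʳ x) ≺ x → σ ⟨$⟩ʳ x ≡ τ ⟨$⟩ʳ x) → ∀ {x} →
      Nesting σ i x → Nesting τ i x
    transfer onσ {x} (i≺x , σi≺i , σx≺σi) =
      i≺x , subst (_≺ i) (onσ σi≺i) σi≺i ,
      subst₂ _≺_ (onσ (≺-trans σx≺σi (≺-trans σi≺i i≺x))) (onσ σi≺i) σx≺σi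

  module _ {σ τ : Permutation′ n}
    (τ-descent : ∀ {i} → (σ ⟨$⟩ʳ i) ≺ i → (τ ⟨$⟩ʳ i) ≺ i)
    (σ-descent : ∀ {i} → (τ ⟨$⟩ʳ i) ≺ i → (σ ⟨$⟩ʳ i) ≺ i)
    (τ-target : ∀ {y} → y ≺ (σ ⟨$⟩ˡ y) → y ≺ (τ ⟨$⟩ˡ y))
    (σ-target : ∀ {y} → y ≺ (τ ⟨$⟩ˡ y) → y ≺ (σ ⟨$⟩ˡ y))
    (nest≡ : ∀ {i} → (σ ⟨$⟩ʳ i) ≺ i → nest σ i ≡ nest τ i) where

    private
      -- A value available at `i` has its preimage beyond it, hence is the image of a descent, in
      -- `τ` as well as in `σ`. Were it taken by `τ` before `i`, then it would be taken at a descent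
      -- where `σ` and `τ` already agree.
      available⊆ : ∀ {σ τ : Permutation′ n} {i} → (∀ {y} → y ≺ (σ ⟨$⟩ˡ y) → y ≺ (τ ⟨$⟩ˡ y)) →
        (∀ {x} → x ≺ i → (τ ⟨$⟩ʳ x) ≺ x → σ ⟨$⟩ʳ x ≡ τ ⟨$⟩ʳ x) → Available σ i ⊆ Available τ i
      available⊆ {σ} {τ} {i} target agree {y} (y≺i , σ⁻¹y⊀i) = y≺i , λ τ⁻¹y≺i →
        σ⁻¹y⊀i (subst (_≺ i) (sym (⟨$⟩ˡ-unique σ (trans
          (agree τ⁻¹y≺i (subst (_≺ (τ ⟨$⟩ˡ y)) (sym (inverseʳ τ)) (target (≺-⊀-trans y≺i σ⁻¹y⊀i))))
          (inverseʳ τ)))) τ⁻¹y≺i)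

      nest-< : ∀ {σ τ : Permutation′ n} {i} → (σ ⟨$⟩ʳ i) ≺ i → (τ ⟨$⟩ʳ i) ≺ i →
        Available σ i ⊆ Available τ i → (σ ⟨$⟩ʳ i) ≺ (τ ⟨$⟩ʳ i) → nest σ i < nest τ i
      nest-< {σ} {τ} {i} σi≺i τi≺i σ⊆τ σi≺τi = subst₂ _<_
        (sym (nest-available σ σi≺i)) (sym (nest-available τ τi≺i))
        (count-< (below? τ i (τ ⟨$⟩ʳ i)) (below? σ i (σ ⟨$⟩ʳ i)) (σ ⟨$⟩ʳ i)
          (λ (av , y≺σi) → σ⊆τ av , ≺-trans y≺σi σi≺τi)
          (σ⊆τ (σi≺i , irrefl (inverseˡ σ)) , σi≺τi) (irrefl refl ∘ proj₂))

    -- Induction along `≺`: agreement at the earlier descents makes the available values coincide,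
    -- and among them a smaller image has strictly smaller rank. Different images at `i` would
    -- therefore give different values of `nest`.
    determined : ∀ {i} → (σ ⟨$⟩ʳ i) ≺ i → σ ⟨$⟩ʳ i ≡ τ ⟨$⟩ʳ i
    determined {i} = go (≺-wellFounded i)
      where
      go : ∀ {i} → Acc _≺_ i → (σ ⟨$⟩ʳ i) ≺ i → σ ⟨$⟩ʳ i ≡ τ ⟨$⟩ʳ i
      go {i} (acc rec) σi≺i with compare (σ ⟨$⟩ʳ i) (τ ⟨$⟩ʳ i)
      ... | tri≈ _ σi≡τi _ = σi≡τi
      ... | tri< σi≺τi _ _ = contradiction
        (nest-< {σ} {τ} σi≺i (τ-descent σi≺i)
          (available⊆ {σ} {τ} τ-target (λ x≺i τx≺x → go (rec x≺i) (σ-descent τx≺x))) σi≺τi)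
        (ℕ.<-irrefl (nest≡ σi≺i))
      ... | tri> _ _ τi≺σi = contradiction
        (nest-< {τ} {σ} (τ-descent σi≺i) σi≺i
          (available⊆ {τ} {σ} σ-target (λ x≺i σx≺x → sym (go (rec x≺i) σx≺x))) τi≺σi)
        (ℕ.<-irrefl (sym (nest≡ σi≺i)))

  available-prefix : ∀ {σ τ : Permutation′ n} {i} → (∀ {x} → x ≺ i → σ ⟨$⟩ʳ x ≡ τ ⟨$⟩ʳ x) →
    Available σ i ⊆ Available τ i
  available-prefix {σ} {τ} {i} agree (y≺i , σ⁻¹y⊀i) = y≺i , λ τ⁻¹y≺i →
    σ⁻¹y⊀i (subst (_≺ i) (sym (⟨$⟩ˡ-unique σ (trans (agree τ⁻¹y≺i) (inverseʳ τ)))) τ⁻¹y≺i)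

  -- Only images of descents may change. As the non-descents are fixed pointwise, the other
  -- comparisons follow. For `ascentˡ`, the new preimage of `y` is either a descent of `π`, hence
  -- one of `σ`, or a fixed non-descent, hence the old preimage.
  record Rearrangement (π σ : Permutation′ n) : Set where
    field
      fixes : ∀ {x} → ¬ (π ⟨$⟩ʳ x) ≺ x → σ ⟨$⟩ʳ x ≡ π ⟨$⟩ʳ x
      keeps : ∀ {x} → (π ⟨$⟩ʳ x) ≺ x → (σ ⟨$⟩ʳ x) ≺ x

    reflects : ∀ {x} → (σ ⟨$⟩ʳ x) ≺ x → (π ⟨$⟩ʳ x) ≺ x
    reflects {x} σx≺x with (π ⟨$⟩ʳ x) ≺? x
    ... | yes πx≺x = πx≺x
    ... | no  πx⊀x = subst (_≺ x) (fixes πx⊀x) σx≺x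

    ascent : ∀ {x} → x ≺ (π ⟨$⟩ʳ x) → x ≺ (σ ⟨$⟩ʳ x)
    ascent {x} x≺πx = subst (x ≺_) (sym (fixes (asym x≺πx))) x≺πx

    ascentˡ : ∀ {y} → y ≺ (π ⟨$⟩ˡ y) → y ≺ (σ ⟨$⟩ˡ y)
    ascentˡ {y} y≺π⁻¹y with (π ⟨$⟩ʳ (σ ⟨$⟩ˡ y)) ≺? (σ ⟨$⟩ˡ y)
    ... | yes descent = subst (_≺ (σ ⟨$⟩ˡ y)) (inverseʳ σ) (keeps descent)
    ... | no ¬descent = subst (y ≺_) (⟨$⟩ˡ-unique π (trans (sym (fixes ¬descent)) (inverseʳ σ))) y≺π⁻¹y

    descentˡ : ∀ {y} → (π ⟨$⟩ˡ y) ≺ y → (σ ⟨$⟩ˡ y) ≺ y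
    descentˡ {y} π⁻¹y≺y = subst (_≺ y) (sym (⟨$⟩ˡ-unique σ (trans
      (fixes (asym (subst ((π ⟨$⟩ˡ y) ≺_) (sym (inverseʳ π)) π⁻¹y≺y))) (inverseʳ π)))) π⁻¹y≺y

  open Rearrangement

  -- Redirecting i to an available y exchanges the images of two positions
  -- that are not before i; so earlier images are final, and the later
  -- availability counts do not change.
  redirect : ∀ (π : Permutation′ n) {i y} → (π ⟨$⟩ʳ i) ≺ i → Available π i y →
    Σ[ σ ∈ Permutation′ n ] Rearrangement π σ
      × σ ⟨$⟩ʳ i ≡ y
      × (∀ {x} → x ≺ i → σ ⟨$⟩ʳ x ≡ π ⟨$⟩ʳ x)
      × (∀ {j} → i ≺ j → count (available? σ j) ≡ count (available? π j))
  redirect π {i} {y} πi≺i (y≺i , z⊀i) = σ , record { fixes = fixes′ ; keeps = keeps′ } , σi≡y ,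
    (λ x≺i → σx≡πx (λ { refl → irrefl refl x≺i }) (λ { refl → z⊀i x≺i })) ,
    λ {j} i≺j → trans (count-available σ j) (trans
      (count-cong (landing? σ j) (landing? π j)
        (λ {x} (σx≺j , x⊀j) → low i≺j x σx≺j , x⊀j)
        (λ {x} (πx≺j , x⊀j) → low′ i≺j x πx≺j , x⊀j))
      (sym (count-available π j)))
    where
    z = π ⟨$⟩ˡ y
    σ = transpose i z ∘ₚ π
    σi≡y : σ ⟨$⟩ʳ i ≡ y
    σi≡y = trans (cong (π ⟨$⟩ʳ_) (transpose-ˡ i z)) (inverseʳ π)
    σz≡πi : σ ⟨$⟩ʳ z ≡ π ⟨$⟩ʳ i
    σz≡πi = cong (π ⟨$⟩ʳ_) (transpose-ʳ i z)
    σx≡πx : ∀ {x} → x ≢ i → x ≢ z → σ ⟨$⟩ʳ x ≡ π ⟨$⟩ʳ x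
    σx≡πx x≢i x≢z = cong (π ⟨$⟩ʳ_) (transpose-≢ x≢i x≢z)
    πz≺i : (π ⟨$⟩ʳ z) ≺ i
    πz≺i = subst (_≺ i) (sym (inverseʳ π)) y≺i
    fixes′ : ∀ {x} → ¬ (π ⟨$⟩ʳ x) ≺ x → σ ⟨$⟩ʳ x ≡ π ⟨$⟩ʳ x
    fixes′ πx⊀x = σx≡πx (λ { refl → πx⊀x πi≺i }) (λ { refl → πx⊀x (≺-⊀-trans πz≺i z⊀i) })
    cases : ∀ x → ((π ⟨$⟩ʳ x) ≺ i × (σ ⟨$⟩ʳ x) ≺ i × ¬ x ≺ i) ⊎ σ ⟨$⟩ʳ x ≡ π ⟨$⟩ʳ x
    cases x = decide (x Fin.≟ i) (x Fin.≟ z)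
      where
      decide : Dec (x ≡ i) → Dec (x ≡ z) →
        ((π ⟨$⟩ʳ x) ≺ i × (σ ⟨$⟩ʳ x) ≺ i × ¬ x ≺ i) ⊎ σ ⟨$⟩ʳ x ≡ π ⟨$⟩ʳ x
      decide (yes refl) _ = inj₁ (πi≺i , subst (_≺ i) (sym σi≡y) y≺i , irrefl refl)
      decide (no _) (yes refl) = inj₁ (πz≺i , subst (_≺ i) (sym σz≡πi) πi≺i , z⊀i)
      decide (no x≢i) (no x≢z) = inj₂ (σx≡πx x≢i x≢z)
    keeps′ : ∀ {x} → (π ⟨$⟩ʳ x) ≺ x → (σ ⟨$⟩ʳ x) ≺ x
    keeps′ {x} πx≺x with cases x
    ... | inj₁ (_ , σx≺i , x⊀i) = ≺-⊀-trans σx≺i x⊀i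
    ... | inj₂ σx≡πx = subst (_≺ x) (sym σx≡πx) πx≺x
    low : ∀ {j} → i ≺ j → ∀ x → (σ ⟨$⟩ʳ x) ≺ j → (π ⟨$⟩ʳ x) ≺ j
    low i≺j x σx≺j with cases x
    ... | inj₁ (πx≺i , _ , _) = ≺-trans πx≺i i≺j
    ... | inj₂ σx≡πx = subst (_≺ _) σx≡πx σx≺j
    low′ : ∀ {j} → i ≺ j → ∀ x → (π ⟨$⟩ʳ x) ≺ j → (σ ⟨$⟩ʳ x) ≺ j
    low′ i≺j x πx≺j with cases x
    ... | inj₁ (_ , σx≺i , _) = ≺-trans σx≺i i≺j
    ... | inj₂ σx≡πx = subst (_≺ _) (sym σx≡πx) πx≺j

  -- Each descent in the list is redirected to the available value of rank `κ i`. The bound on `κ`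
  -- is stated for the initial `π` and survives because a redirection does not change later
  -- availability counts. The clause about positions before the whole list carries the induction: by
  -- `nest-available`, `nest` at `i` depends only on the images up to `i`, which later redirections
  -- leave alone.
  prescribe : (κ : Fin n → ℕ) (xs : List.List (Fin n)) → ListAllPairs.AllPairs _≺_ xs → (π : Permutation′ n) →
    (∀ {i} → i List.∈ xs → (π ⟨$⟩ʳ i) ≺ i → κ i < count (available? π i)) →
    Σ[ σ ∈ Permutation′ n ] Rearrangement π σ
      × (∀ {x} → ListAll.All (x ≺_) xs → σ ⟨$⟩ʳ x ≡ π ⟨$⟩ʳ x)
      × (∀ {i} → i List.∈ xs → (π ⟨$⟩ʳ i) ≺ i → nest σ i ≡ κ i)
  prescribe κ [] [] π κ< = π , record { fixes = λ _ → refl ; keeps = id } , (λ _ → refl) , λ ()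
  prescribe κ (i ∷ xs) (i≺xs ∷ xs-sorted) π κ< with (π ⟨$⟩ʳ i) ≺? i
  ... | no πi⊀i with prescribe κ xs xs-sorted π (κ< ∘ there)
  ...   | σ , rearr , outside , nest≡κ = σ , rearr , outside ∘ ListAll.tail , λ
    { (here refl) πi≺i → contradiction πi≺i πi⊀i ; (there j∈xs) → nest≡κ j∈xs }
  prescribe κ (i ∷ xs) (i≺xs ∷ xs-sorted) π κ< | yes πi≺i
    with select (κ i) (available? π i) (κ< (here refl) πi≺i)
  ... | y , y-available , rank-y
    with redirect π πi≺i y-available
  ... | π′ , π→π′ , π′i≡y , π′-prefix , π′-available
    with prescribe κ xs xs-sorted π′ (λ {j} j∈xs π′j≺j →
           subst (κ j <_) (sym (π′-available (ListAll.lookup i≺xs j∈xs))) (κ< (there j∈xs) (reflects π→π′ π′j≺j)))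
  ... | σ , π′→σ , outside , nest≡κ = σ ,
    record { fixes = λ πx⊀x → trans (fixes π′→σ (πx⊀x ∘ reflects π→π′)) (fixes π→π′ πx⊀x)
           ; keeps = keeps π′→σ ∘ keeps π→π′ } ,
    (λ { (x≺i ListAll.∷ x≺xs) → trans (outside x≺xs) (π′-prefix x≺i) }) ,
    λ { (here refl) _ → nest-i ; (there j∈xs) πj≺j → nest≡κ j∈xs (keeps π→π′ πj≺j) }
    where
    prefix : ∀ {x} → x ≺ i → σ ⟨$⟩ʳ x ≡ π ⟨$⟩ʳ x
    prefix x≺i = trans (outside (ListAll.map (≺-trans x≺i) i≺xs)) (π′-prefix x≺i)
    σi≡y : σ ⟨$⟩ʳ i ≡ y
    σi≡y = trans (outside i≺xs) π′i≡y
    nest-i : nest σ i ≡ κ i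
    nest-i = trans (nest-available σ (subst (_≺ i) (sym σi≡y) (proj₁ y-available))) (trans
      (count-cong (below? σ i (σ ⟨$⟩ʳ i)) (below? π i y)
        (λ (av , z≺σi) → available-prefix {σ} {π} prefix av , subst (_ ≺_) σi≡y z≺σi)
        (λ (av , z≺y) → available-prefix {π} {σ} (sym ∘ prefix) av , subst (_ ≺_) (sym σi≡y) z≺y))
      rank-y)

module Aexc {n : ℕ} = Descents (Fin.<-isStrictTotalOrder {n}) Fin._<?_
module Exc {n : ℕ} = Descents (Flip.isStrictTotalOrder (Fin.<-isStrictTotalOrder {n})) (flip Fin._<?_)

-- Kinds of steps and their labels

data Side : Set where
  below above equal : Side

OnSide : Side → ∀ {n} → Fin n → Fin n → Set
OnSide below i x = x Fin.< i
OnSide above i x = i Fin.< x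
OnSide equal i x = i ≡ x

onSide-unique : ∀ {n} {i x : Fin n} o o′ → OnSide o i x → OnSide o′ i x → o ≡ o′
onSide-unique below below _ _ = refl
onSide-unique below above x<i i<x = contradiction i<x (Fin.<-asym x<i)
onSide-unique below equal x<i i≡x = contradiction x<i (Fin.<-irrefl (sym i≡x))
onSide-unique above below i<x x<i = contradiction i<x (Fin.<-asym x<i)
onSide-unique above above _ _ = refl
onSide-unique above equal i<x i≡x = contradiction i<x (Fin.<-irrefl i≡x)
onSide-unique equal below i≡x x<i = contradiction x<i (Fin.<-irrefl (sym i≡x))
onSide-unique equal above i≡x i<x = contradiction i<x (Fin.<-irrefl i≡x)
onSide-unique equal equal _ _ = refl

data Kind : Set where
  opener linkedExc linkedAexc closer fixed : Kind

image preimage : Kind → Side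
image opener     = above
image linkedExc  = above
image linkedAexc = below
image closer     = below
image fixed      = equal
preimage opener     = above
preimage linkedExc  = below
preimage linkedAexc = above
preimage closer     = below
preimage fixed      = equal

HasKind : ∀ {n} → Permutation′ n → Fin n → Kind → Set
HasKind σ i κ = OnSide (image κ) i (σ ⟨$⟩ʳ i) × OnSide (preimage κ) i (σ ⟨$⟩ˡ i)

kind : ∀ {n} (σ : Permutation′ n) i → ∃[ κ ] HasKind σ i κ
kind σ i with Fin.<-cmp i (σ ⟨$⟩ʳ i) | Fin.<-cmp i (σ ⟨$⟩ˡ i)
... | tri< i<σi _ _ | tri< i<σ⁻¹i _ _ = opener , i<σi , i<σ⁻¹i
... | tri< i<σi _ _ | tri> _ _ σ⁻¹i<i = linkedExc , i<σi , σ⁻¹i<i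
... | tri> _ _ σi<i | tri< i<σ⁻¹i _ _ = linkedAexc , σi<i , i<σ⁻¹i
... | tri> _ _ σi<i | tri> _ _ σ⁻¹i<i = closer , σi<i , σ⁻¹i<i
... | tri≈ _ i≡σi _ | _ = fixed , i≡σi , sym (⟨$⟩ˡ-unique σ (sym i≡σi))
... | tri< i<σi _ _ | tri≈ _ i≡σ⁻¹i _ = contradiction i<σi (Fin.<-irrefl (sym (⟨$⟩ʳ-unique σ (sym i≡σ⁻¹i))))
... | tri> _ _ σi<i | tri≈ _ i≡σ⁻¹i _ = contradiction σi<i (Fin.<-irrefl (⟨$⟩ʳ-unique σ (sym i≡σ⁻¹i)))

step : Kind → ℕ → ℕ → LabeledStep
step opener     x y = up    , c ^ x · d ^ y · p
step linkedExc  x y = level , a ^ x · b ^ y · s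
step linkedAexc x y = level , f ^ x · g ^ y · t
step closer     x y = down  , h ^ x · ℓ ^ y · r
step fixed      x y = level , u · w ^ x

-- Level steps are told apart by the exponents of `s` (index 10) and `t` (index 11). The first
-- exponent is then read off at `c`, `h`, `a`, `f` or `w`.
decode : LabeledStep → Kind × ℕ
decode (up    , m) = opener , lookup m (# 2)
decode (down  , m) = closer , lookup m (# 6)
decode (level , m) with lookup m (# 10) | lookup m (# 11)
... | suc _ | _     = linkedExc  , lookup m (# 0)
... | zero  | suc _ = linkedAexc , lookup m (# 4)
... | zero  | zero  = fixed      , lookup m (# 13)

decode-step : ∀ κ x y → decode (step κ x y) ≡ (κ , x)
decode-step opener x y rewrite ℕ.*-identityʳ x | ℕ.*-zeroʳ y | ℕ.+-identityʳ x | ℕ.+-identityʳ x = refl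
decode-step linkedExc x y rewrite ℕ.*-identityʳ x | ℕ.*-zeroʳ x | ℕ.*-zeroʳ y | ℕ.+-identityʳ x | ℕ.+-identityʳ x = refl
decode-step linkedAexc x y rewrite ℕ.*-identityʳ x | ℕ.*-zeroʳ x | ℕ.*-zeroʳ y | ℕ.+-identityʳ x | ℕ.+-identityʳ x = refl
decode-step closer x y rewrite ℕ.*-identityʳ x | ℕ.*-zeroʳ y | ℕ.+-identityʳ x | ℕ.+-identityʳ x = refl
decode-step fixed x y rewrite ℕ.*-identityʳ x | ℕ.*-zeroʳ x = refl

step-injective : ∀ {κ κ′ x x′ y y′} → step κ x y ≡ step κ′ x′ y′ → κ ≡ κ′ × x ≡ x′
step-injective {κ} {κ′} {x} {x′} {y} {y′} eq = cong proj₁ codes , cong proj₂ codes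
  where
  codes : (κ , x) ≡ (κ′ , x′)
  codes = trans (sym (decode-step κ x y)) (trans (cong decode eq) (decode-step κ′ x′ y′))

-- Motzkin paths in terms of kinds and exponents

-- Valid κ k k′ x y: a step of kind κ from height k to height k′ may carry the
-- exponents x and y.
data Valid : Kind → (k k′ x y : ℕ) → Set where
  opener     : ∀ {k x y} → x + y ≡ k       → Valid opener k (suc k) x y
  linkedExc  : ∀ {k x y} → suc (x + y) ≡ k → Valid linkedExc k k x y
  linkedAexc : ∀ {k x y} → suc (x + y) ≡ k → Valid linkedAexc k k x y
  closer     : ∀ {k x y} → x + y ≡ k       → Valid closer (suc k) k x y
  fixed      : ∀ {k x}   → x ≡ k           → Valid fixed k k x 0

infixr 5 _∷_

-- A form of `MotzkinFrom` adapted to `ηStep`: both exponents are explicit and tied to the height by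
-- `Valid`, and the labels are written in the factor order used by `ηStep`.
data Coded : ℕ → ∀ {m} → Vec LabeledStep m → Set where
  []  : Coded 0 []
  _∷_ : ∀ {κ k k′ x y m} {M : Vec LabeledStep m} → Valid κ k k′ x y →
        Coded k′ M → Coded k (step κ x y ∷ M)

·-rotate : ∀ m m₁ m₂ → m₁ · m₂ · m ≡ m · m₁ · m₂
·-rotate m m₁ m₂ = trans (Vec.zipWith-comm ℕ.+-comm (m₁ · m₂) m) (sym (Vec.zipWith-assoc ℕ.+-assoc m m₁ m₂))

label-motzkin : ∀ (m₀ m₁ m₂ : Monomial) x y {k} → suc (x + y) ≡ k →
  Σ[ i ∈ Fin k ] m₁ ^ x · m₂ ^ y · m₀ ≡ m₀ · m₁ ^ toℕ i · m₂ ^ (k ∸ 1 ∸ toℕ i)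
label-motzkin m₀ m₁ m₂ x y refl = i , trans (·-rotate m₀ (m₁ ^ x) (m₂ ^ y))
  (cong₂ (λ x y → m₀ · m₁ ^ x · m₂ ^ y) (sym toℕi≡x)
    (sym (trans (cong (x + y ∸_) toℕi≡x) (ℕ.m+n∸m≡n x y))))
  where
  i = fromℕ< (ℕ.s≤s (ℕ.m≤m+n x y))
  toℕi≡x : toℕ i ≡ x
  toℕi≡x = Fin.toℕ-fromℕ< (ℕ.s≤s (ℕ.m≤m+n x y))

motzkin-label : ∀ (m₀ m₁ m₂ : Monomial) {k} (i : Fin k) →
  ∃[ y ] suc (toℕ i + y) ≡ k ×
    m₁ ^ toℕ i · m₂ ^ y · m₀ ≡ m₀ · m₁ ^ toℕ i · m₂ ^ (k ∸ 1 ∸ toℕ i)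
motzkin-label m₀ m₁ m₂ {suc k} i = k ∸ toℕ i , cong suc (ℕ.m+[n∸m]≡n (ℕ.s≤s⁻¹ (Fin.toℕ<n i))) ,
  ·-rotate m₀ (m₁ ^ toℕ i) (m₂ ^ (k ∸ toℕ i))

coded⇒motzkin : ∀ {k m} {M : Vec LabeledStep m} → Coded k M → MotzkinFrom k M
coded⇒motzkin []                                   = []
coded⇒motzkin (opener {x = x} {y} x+y≡k       ∷ C) =
  up∷ (label-motzkin p c d x y (cong suc x+y≡k)) (coded⇒motzkin C)
coded⇒motzkin (linkedExc {x = x} {y} 1+x+y≡k  ∷ C) =
  level∷ (inj₂ (inj₁ (label-motzkin s a b x y 1+x+y≡k))) (coded⇒motzkin C)
coded⇒motzkin (linkedAexc {x = x} {y} 1+x+y≡k ∷ C) =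
  level∷ (inj₂ (inj₂ (label-motzkin t f g x y 1+x+y≡k))) (coded⇒motzkin C)
coded⇒motzkin (closer {x = x} {y} x+y≡k       ∷ C) =
  down∷ (label-motzkin r h ℓ x y (cong suc x+y≡k)) (coded⇒motzkin C)
coded⇒motzkin (fixed refl                     ∷ C) = level∷ (inj₁ refl) (coded⇒motzkin C)

motzkin⇒coded : ∀ {k m} {M : Vec LabeledStep m} → MotzkinFrom k M → Coded k M
motzkin⇒coded [] = []
motzkin⇒coded (up∷ {k} {M = M} (i , refl) P) with y , eq , label ← motzkin-label p c d i =
  subst (λ m → Coded k ((up , m) ∷ M)) label
    (opener {x = toℕ i} {y} (ℕ.suc-injective eq) ∷ motzkin⇒coded P)
motzkin⇒coded (level∷ (inj₁ refl) P) = fixed refl ∷ motzkin⇒coded P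
motzkin⇒coded (level∷ {k} {M = M} (inj₂ (inj₁ (i , refl))) P) with y , eq , label ← motzkin-label s a b i =
  subst (λ m → Coded k ((level , m) ∷ M)) label (linkedExc {x = toℕ i} {y} eq ∷ motzkin⇒coded P)
motzkin⇒coded (level∷ {k} {M = M} (inj₂ (inj₂ (i , refl))) P) with y , eq , label ← motzkin-label t f g i =
  subst (λ m → Coded k ((level , m) ∷ M)) label (linkedAexc {x = toℕ i} {y} eq ∷ motzkin⇒coded P)
motzkin⇒coded (down∷ {k} {M = M} (i , refl) P) with y , eq , label ← motzkin-label r h ℓ i =
  subst (λ m → Coded (suc k) ((down , m) ∷ M)) label
    (closer {x = toℕ i} {y} (ℕ.suc-injective eq) ∷ motzkin⇒coded P)

-- The height of the path in terms of the permutation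

-- The argument is a natural number and not a position, so that the end of the path, `m = n`, is
-- included.
height : ∀ {n} → Permutation′ n → ℕ → ℕ
height σ m = count λ x → toℕ x <? m ×-dec m ≤? toℕ (σ ⟨$⟩ʳ x)

height-0 : ∀ {n} (σ : Permutation′ n) → height σ 0 ≡ 0
height-0 σ = count-∅ (λ x → toℕ x <? 0 ×-dec 0 ≤? toℕ (σ ⟨$⟩ʳ x)) λ ()

height-end : ∀ {n} (σ : Permutation′ n) → height σ n ≡ 0
height-end {n} σ = count-∅ (λ x → toℕ x <? n ×-dec n ≤? toℕ (σ ⟨$⟩ʳ x))
  λ (_ , n≤σx) → ℕ.<⇒≱ (Fin.toℕ<n _) n≤σx

module _ {n} (σ : Permutation′ n) (i : Fin n) where

  private
    before? = λ x → toℕ x <? toℕ i ×-dec toℕ i ≤? toℕ (σ ⟨$⟩ʳ x)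
    after?  = λ x → toℕ x <? suc (toℕ i) ×-dec suc (toℕ i) ≤? toℕ (σ ⟨$⟩ʳ x)

    ≤-split : ∀ {x y : Fin n} → toℕ x ≤ toℕ y → x ≡ y ⊎ x Fin.< y
    ≤-split x≤y with ℕ.m≤n⇒m<n∨m≡n x≤y
    ... | inj₁ x<y = inj₂ x<y
    ... | inj₂ x≡y = inj₁ (Fin.toℕ-injective x≡y)

  -- The heights on the two sides of step `i` exceed `Exc.span σ i` by at most one: before the step
  -- σ⁻¹(i) is counted if it lies below `i`, and after the step `i` is counted if it is an
  -- excedance. This and the next three lemmas are the four cases.
  height-before-linked : (σ ⟨$⟩ˡ i) Fin.< i → height σ (toℕ i) ≡ suc (Exc.span σ i)
  height-before-linked σ⁻¹i<i = count-insert before? (Exc.spanning? σ i) (σ ⟨$⟩ˡ i)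
    (λ (x<i , i<σx) → x<i , ℕ.<⇒≤ i<σx)
    (σ⁻¹i<i , ℕ.≤-reflexive (cong toℕ (sym (inverseʳ σ))))
    (λ (_ , i<σσ⁻¹i) → Fin.<-irrefl (sym (inverseʳ σ)) i<σσ⁻¹i)
    split
    where
    split : ∀ {x} → x Fin.< i × i Fin.≤ (σ ⟨$⟩ʳ x) → x ≡ (σ ⟨$⟩ˡ i) ⊎ Exc.Spanning σ i x
    split (x<i , i≤σx) with ≤-split i≤σx
    ... | inj₁ i≡σx = inj₁ (sym (⟨$⟩ˡ-unique σ (sym i≡σx)))
    ... | inj₂ i<σx = inj₂ (x<i , i<σx)

  height-before-unlinked : ¬ (σ ⟨$⟩ˡ i) Fin.< i → height σ (toℕ i) ≡ Exc.span σ i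
  height-before-unlinked σ⁻¹i≮i = count-cong before? (Exc.spanning? σ i) to
    (λ (x<i , i<σx) → x<i , ℕ.<⇒≤ i<σx)
    where
    to : ∀ {x} → x Fin.< i × i Fin.≤ (σ ⟨$⟩ʳ x) → Exc.Spanning σ i x
    to (x<i , i≤σx) with ≤-split i≤σx
    ... | inj₁ i≡σx = contradiction (subst (Fin._< i) (sym (⟨$⟩ˡ-unique σ (sym i≡σx))) x<i) σ⁻¹i≮i
    ... | inj₂ i<σx = x<i , i<σx

  height-after-exc : i Fin.< (σ ⟨$⟩ʳ i) → height σ (suc (toℕ i)) ≡ suc (Exc.span σ i)
  height-after-exc i<σi = count-insert after? (Exc.spanning? σ i) i
    (λ (x<i , i<σx) → ℕ.m<n⇒m<1+n x<i , i<σx)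
    (ℕ.≤-refl , i<σi)
    (λ (i<i , _) → Fin.<-irrefl refl i<i)
    split
    where
    split : ∀ {x} → toℕ x < suc (toℕ i) × i Fin.< (σ ⟨$⟩ʳ x) → x ≡ i ⊎ Exc.Spanning σ i x
    split (x<1+i , i<σx) with ≤-split (ℕ.s≤s⁻¹ x<1+i)
    ... | inj₁ x≡i = inj₁ x≡i
    ... | inj₂ x<i = inj₂ (x<i , i<σx)

  height-after-nonexc : ¬ i Fin.< (σ ⟨$⟩ʳ i) → height σ (suc (toℕ i)) ≡ Exc.span σ i
  height-after-nonexc i≮σi = count-cong after? (Exc.spanning? σ i) to
    (λ (x<i , i<σx) → ℕ.m<n⇒m<1+n x<i , i<σx)
    where
    to : ∀ {x} → toℕ x < suc (toℕ i) × i Fin.< (σ ⟨$⟩ʳ x) → Exc.Spanning σ i x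
    to (x<1+i , i<σx) with ≤-split (ℕ.s≤s⁻¹ x<1+i)
    ... | inj₁ refl = contradiction i<σx i≮σi
    ... | inj₂ x<i = x<i , i<σx

  -- A permutation moves as many positions out of {x | x < i} as into it.
  height-balance : height σ (toℕ i) ≡ count (Aexc.landing? σ i)
  height-balance = ℕ.+-cancelʳ-≡ (count both?) (count before?) (count (Aexc.landing? σ i)) (begin
    count before? + count both?              ≡⟨ count-⊎ source? before? both? proj₁ proj₁ split₁
                                                  (λ (_ , i≤σx) (_ , σx<i) → ℕ.<⇒≱ σx<i i≤σx) ⟨
    count source?                            ≡⟨ count-permute source? σ ⟩
    count target?                            ≡⟨ count-⊎ target? (Aexc.landing? σ i) both? proj₁ proj₂ split₂
                                                  (λ (_ , x≮i) (x<i , _) → x≮i x<i) ⟩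
    count (Aexc.landing? σ i) + count both?  ∎)
    where
    open ≡-Reasoning
    source? = λ x → x Fin.<? i
    target? = λ x → (σ ⟨$⟩ʳ x) Fin.<? i
    both?   = λ x → x Fin.<? i ×-dec (σ ⟨$⟩ʳ x) Fin.<? i
    split₁ : ∀ {x} → x Fin.< i →
      (x Fin.< i × i Fin.≤ (σ ⟨$⟩ʳ x)) ⊎ (x Fin.< i × (σ ⟨$⟩ʳ x) Fin.< i)
    split₁ {x} x<i with (σ ⟨$⟩ʳ x) Fin.<? i
    ... | yes σx<i = inj₂ (x<i , σx<i)
    ... | no  σx≮i = inj₁ (x<i , ℕ.≮⇒≥ σx≮i)
    split₂ : ∀ {x} → (σ ⟨$⟩ʳ x) Fin.< i → Aexc.Landing σ i x ⊎ (x Fin.< i × (σ ⟨$⟩ʳ x) Fin.< i)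
    split₂ {x} σx<i with x Fin.<? i
    ... | yes x<i = inj₂ (x<i , σx<i)
    ... | no  x≮i = inj₁ (σx<i , x≮i)

  -- The height is defined by positions mapped upwards; balance rewrites it as a count of available
  -- values, which ties the anti-excedance labels to it as well.
  height-before-aexc : (σ ⟨$⟩ʳ i) Fin.< i → height σ (toℕ i) ≡ suc (Aexc.span σ i)
  height-before-aexc σi<i = trans height-balance
    (trans (sym (Aexc.count-available σ i)) (Aexc.count-available-descent σ σi<i))

-- The steps of a permutation form a Motzkin path

major minor : Kind → ∀ {n} → Permutation′ n → Fin n → ℕ
major opener     σ i = Exc.nest σ i
major linkedExc  σ i = Exc.nest σ i
major linkedAexc σ i = Aexc.nest σ i
major closer     σ i = Aexc.nest σ i
major fixed      σ i = Exc.span σ i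
minor opener     σ i = Exc.cross σ i
minor linkedExc  σ i = Exc.cross σ i
minor linkedAexc σ i = Aexc.cross σ i
minor closer     σ i = Aexc.cross σ i
-- A fixed point carries one exponent only; `0` is the placeholder that `Valid` demands.
minor fixed      σ i = 0

valid : ∀ {n} (σ : Permutation′ n) {i} κ → HasKind σ i κ →
  Valid κ (height σ (toℕ i)) (height σ (suc (toℕ i))) (major κ σ i) (minor κ σ i)
valid σ {i} opener (i<σi , i<σ⁻¹i)
  rewrite height-before-unlinked σ i (Fin.<-asym i<σ⁻¹i) | height-after-exc σ i i<σi =
  opener (sym (Exc.nest+cross σ i<σi))
valid σ {i} linkedExc (i<σi , σ⁻¹i<i)
  rewrite height-before-linked σ i σ⁻¹i<i | height-after-exc σ i i<σi =
  linkedExc (cong suc (sym (Exc.nest+cross σ i<σi)))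
valid σ {i} linkedAexc (σi<i , i<σ⁻¹i)
  -- The height after the step is `Exc.span σ i`, which is also the height before it, and that is
  -- `suc (Aexc.span σ i)`.
  rewrite height-after-nonexc σ i (Fin.<-asym σi<i)
        | sym (height-before-unlinked σ i (Fin.<-asym i<σ⁻¹i))
        | height-before-aexc σ i σi<i =
  linkedAexc (cong suc (sym (Aexc.nest+cross σ σi<i)))
valid σ {i} closer (σi<i , σ⁻¹i<i)
  -- Both formulas for the height before the step apply; comparing them gives
  -- `Exc.span σ i ≡ Aexc.span σ i`.
  rewrite height-after-nonexc σ i (Fin.<-asym σi<i)
        | sym (ℕ.suc-injective (trans (sym (height-before-aexc σ i σi<i)) (height-before-linked σ i σ⁻¹i<i)))
        | height-before-aexc σ i σi<i =
  closer (sym (Aexc.nest+cross σ σi<i))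
valid σ {i} fixed (i≡σi , i≡σ⁻¹i)
  rewrite height-before-unlinked σ i (Fin.<-irrefl (sym i≡σ⁻¹i)) | height-after-nonexc σ i (Fin.<-irrefl i≡σi) =
  fixed refl

ηStep-kind : ∀ {n} (σ : Permutation′ n) {i} κ → HasKind σ i κ →
  ηStep σ i ≡ step κ (major κ σ i) (minor κ σ i)
ηStep-kind σ {i} κ (im , pre) with Fin.<-cmp i (σ ⟨$⟩ʳ i)
ηStep-kind σ {i} opener (_ , i<σ⁻¹i) | tri< _ _ _
  rewrite dec-false ((σ ⟨$⟩ˡ i) Fin.<? i) (Fin.<-asym i<σ⁻¹i) = refl
ηStep-kind σ {i} linkedExc (_ , σ⁻¹i<i) | tri< _ _ _
  rewrite dec-true ((σ ⟨$⟩ˡ i) Fin.<? i) σ⁻¹i<i = refl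
ηStep-kind σ linkedAexc (σi<i , _) | tri< _ _ σi≮i = contradiction σi<i σi≮i
ηStep-kind σ closer     (σi<i , _) | tri< _ _ σi≮i = contradiction σi<i σi≮i
ηStep-kind σ fixed      (i≡σi , _) | tri< _ i≢σi _ = contradiction i≡σi i≢σi
ηStep-kind σ opener     (i<σi , _) | tri≈ i≮σi _ _ = contradiction i<σi i≮σi
ηStep-kind σ linkedExc  (i<σi , _) | tri≈ i≮σi _ _ = contradiction i<σi i≮σi
ηStep-kind σ linkedAexc (σi<i , _) | tri≈ _ _ σi≮i = contradiction σi<i σi≮i
ηStep-kind σ closer     (σi<i , _) | tri≈ _ _ σi≮i = contradiction σi<i σi≮i
ηStep-kind σ fixed      _          | tri≈ _ _ _    = refl
ηStep-kind σ opener     (i<σi , _) | tri> i≮σi _ _ = contradiction i<σi i≮σi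
ηStep-kind σ linkedExc  (i<σi , _) | tri> i≮σi _ _ = contradiction i<σi i≮σi
ηStep-kind σ {i} linkedAexc (_ , i<σ⁻¹i) | tri> _ _ _
  rewrite dec-true (i Fin.<? (σ ⟨$⟩ˡ i)) i<σ⁻¹i = refl
ηStep-kind σ {i} closer (_ , σ⁻¹i<i) | tri> _ _ _
  rewrite dec-false (i Fin.<? (σ ⟨$⟩ˡ i)) (Fin.<-asym σ⁻¹i<i) = refl
ηStep-kind σ fixed      (i≡σi , _) | tri> _ i≢σi _ = contradiction i≡σi i≢σi

ηSteps-coded : ∀ {n} (σ : Permutation′ n) → Coded 0 (ηSteps σ)
ηSteps-coded {n} σ = subst (λ k → Coded k (ηSteps σ)) (height-0 σ) (go n 0 id (λ _ → refl) refl)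
  where
  -- Induction over suffixes of the path: `pos` embeds the `m` remaining indices as the positions
  -- from `i` on.
  go : ∀ m i (pos : Fin m → Fin n) → (∀ j → toℕ (pos j) ≡ i + toℕ j) → i + m ≡ n →
    Coded (height σ i) (tabulate (ηStep σ ∘ pos))
  go zero i pos pos≡ i+0≡n = subst (λ k → Coded k [])
    (sym (trans (cong (height σ) (trans (sym (ℕ.+-identityʳ i)) i+0≡n)) (height-end σ))) []
  go (suc m) i pos pos≡ i+1+m≡n with kind σ (pos zero)
  ... | κ , hasKind = subst (λ st → Coded (height σ i) (st ∷ _)) (sym (ηStep-kind σ κ hasKind))
    (subst₂ (λ k k′ → Valid κ k k′ (major κ σ (pos zero)) (minor κ σ (pos zero)))
      (cong (height σ) pos-zero) (cong (height σ ∘ suc) pos-zero) (valid σ κ hasKind)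
      ∷ go m (suc i) (pos ∘ suc) (λ j → trans (pos≡ (suc j)) (ℕ.+-suc i (toℕ j)))
           (trans (sym (ℕ.+-suc i m)) i+1+m≡n))
    where
    pos-zero : toℕ (pos zero) ≡ i
    pos-zero = trans (pos≡ zero) (ℕ.+-identityʳ i)

-- Injectivity

module _ {n} {σ τ : Permutation′ n} {i : Fin n} κ (hσ : HasKind σ i κ) (hτ : HasKind τ i κ) where

  same-image : ∀ o → OnSide o i (σ ⟨$⟩ʳ i) → OnSide o i (τ ⟨$⟩ʳ i)
  same-image o on = subst (λ o → OnSide o i (τ ⟨$⟩ʳ i)) (onSide-unique (image κ) o (proj₁ hσ) on) (proj₁ hτ)

  same-preimage : ∀ o → OnSide o i (σ ⟨$⟩ˡ i) → OnSide o i (τ ⟨$⟩ˡ i)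
  same-preimage o on = subst (λ o → OnSide o i (τ ⟨$⟩ˡ i)) (onSide-unique (preimage κ) o (proj₂ hσ) on) (proj₂ hτ)

major-below : ∀ κ → image κ ≡ below → ∀ {n} (σ : Permutation′ n) i → major κ σ i ≡ Aexc.nest σ i
major-below linkedAexc _ σ i = refl
major-below closer     _ σ i = refl

major-above : ∀ κ → image κ ≡ above → ∀ {n} (σ : Permutation′ n) i → major κ σ i ≡ Exc.nest σ i
major-above opener    _ σ i = refl
major-above linkedExc _ σ i = refl

module _ {n} {σ τ : Permutation′ n} (ησ≡ητ : ∀ i → ηStep σ i ≡ ηStep τ i) where

  private
    shared : ∀ i → ∃[ κ ] HasKind σ i κ × HasKind τ i κ × major κ σ i ≡ major κ τ i
    shared i with kind σ i | kind τ i
    ... | κ , hσ | κ′ , hτ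
      with step-injective {κ} {κ′} {y = minor κ σ i} {minor κ′ τ i}
             (trans (sym (ηStep-kind σ κ hσ)) (trans (ησ≡ητ i) (ηStep-kind τ κ′ hτ)))
    ... | refl , major≡ = κ , hσ , hτ , major≡

    nest-below : ∀ {i} → (σ ⟨$⟩ʳ i) Fin.< i → Aexc.nest σ i ≡ Aexc.nest τ i
    nest-below {i} σi<i with κ , hσ , hτ , major≡ ← shared i
      with below≡ ← onSide-unique (image κ) below (proj₁ hσ) σi<i =
      trans (sym (major-below κ below≡ σ i)) (trans major≡ (major-below κ below≡ τ i))

    nest-above : ∀ {i} → i Fin.< (σ ⟨$⟩ʳ i) → Exc.nest σ i ≡ Exc.nest τ i
    nest-above {i} i<σi with κ , hσ , hτ , major≡ ← shared i
      with above≡ ← onSide-unique (image κ) above (proj₁ hσ) i<σi =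
      trans (sym (major-above κ above≡ σ i)) (trans major≡ (major-above κ above≡ τ i))

    to : ∀ o {i} → OnSide o i (σ ⟨$⟩ʳ i) → OnSide o i (τ ⟨$⟩ʳ i)
    to o {i} with κ , hσ , hτ , _ ← shared i = same-image {σ = σ} {τ} κ hσ hτ o

    from : ∀ o {i} → OnSide o i (τ ⟨$⟩ʳ i) → OnSide o i (σ ⟨$⟩ʳ i)
    from o {i} with κ , hσ , hτ , _ ← shared i = same-image {σ = τ} {σ} κ hτ hσ o

    toˡ : ∀ o {i} → OnSide o i (σ ⟨$⟩ˡ i) → OnSide o i (τ ⟨$⟩ˡ i)
    toˡ o {i} with κ , hσ , hτ , _ ← shared i = same-preimage {σ = σ} {τ} κ hσ hτ o

    fromˡ : ∀ o {i} → OnSide o i (τ ⟨$⟩ˡ i) → OnSide o i (σ ⟨$⟩ˡ i)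
    fromˡ o {i} with κ , hσ , hτ , _ ← shared i = same-preimage {σ = τ} {σ} κ hτ hσ o

  ηStep-injective : σ ≈ τ
  ηStep-injective i with Fin.<-cmp i (σ ⟨$⟩ʳ i)
  -- In the reversed order the image of a descent is a value whose preimage lies `below` it.
  ... | tri< i<σi _ _ = Exc.determined {σ = σ} {τ}
    (to above) (from above) (toˡ below) (fromˡ below) nest-above i<σi
  ... | tri≈ _ i≡σi _ = trans (sym i≡σi) (to equal i≡σi)
  ... | tri> _ _ σi<i = Aexc.determined {σ = σ} {τ}
    (to below) (from below) (toˡ above) (fromˡ above) nest-below σi<i

-- Exponents at equal heights, and congruence

-- The height fixes the sum of the two exponents, and for a fixed point it fixes the only exponent;
-- so first exponents have to be compared for the other kinds alone.
valid-agree : ∀ {κ k k′ x x′ y y′} → Valid κ k k′ x y → Valid κ k k′ x′ y′ →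
  (image κ ≢ equal → x ≡ x′) → x ≡ x′ × y ≡ y′
valid-agree {x = x} (opener eq) (opener eq′) x≡x′ with refl ← x≡x′ (λ ()) =
  refl , ℕ.+-cancelˡ-≡ x _ _ (trans eq (sym eq′))
valid-agree {x = x} (linkedExc eq) (linkedExc eq′) x≡x′ with refl ← x≡x′ (λ ()) =
  refl , ℕ.+-cancelˡ-≡ x _ _ (ℕ.suc-injective (trans eq (sym eq′)))
valid-agree {x = x} (linkedAexc eq) (linkedAexc eq′) x≡x′ with refl ← x≡x′ (λ ()) =
  refl , ℕ.+-cancelˡ-≡ x _ _ (ℕ.suc-injective (trans eq (sym eq′)))
valid-agree {x = x} (closer eq) (closer eq′) x≡x′ with refl ← x≡x′ (λ ()) =
  refl , ℕ.+-cancelˡ-≡ x _ _ (trans eq (sym eq′))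
valid-agree (fixed x≡k) (fixed x′≡k) _ = trans x≡k (sym x′≡k) , refl

valid-functional : ∀ {κ k k₁ k₂ x x′ y y′} → Valid κ k k₁ x y → Valid κ k k₂ x′ y′ → k₁ ≡ k₂
valid-functional (opener _)     (opener _)     = refl
valid-functional (linkedExc _)  (linkedExc _)  = refl
valid-functional (linkedAexc _) (linkedAexc _) = refl
valid-functional (closer _)     (closer _)     = refl
valid-functional (fixed _)      (fixed _)      = refl

valid-≤ : ∀ {κ k k′ x x′ y y′} → image κ ≢ equal → Valid κ k k′ x y → Valid κ k k′ x′ y′ → x ≤ x′ + y′
valid-≤ _ (opener {x = x} eq) (opener eq′) = subst (x ≤_) (trans eq (sym eq′)) (ℕ.m≤m+n x _)
valid-≤ _ (linkedExc {x = x} eq) (linkedExc eq′) =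
  subst (x ≤_) (ℕ.suc-injective (trans eq (sym eq′))) (ℕ.m≤m+n x _)
valid-≤ _ (linkedAexc {x = x} eq) (linkedAexc eq′) =
  subst (x ≤_) (ℕ.suc-injective (trans eq (sym eq′))) (ℕ.m≤m+n x _)
valid-≤ _ (closer {x = x} eq) (closer eq′) = subst (x ≤_) (trans eq (sym eq′)) (ℕ.m≤m+n x _)
valid-≤ notFixed (fixed _) _ = contradiction refl notFixed

height-cong : ∀ {n} {σ τ : Permutation′ n} → σ ≈ τ → ∀ m → height σ m ≡ height τ m
height-cong {σ = σ} {τ} σ≈τ m = count-cong
  (λ x → toℕ x <? m ×-dec m ≤? toℕ (σ ⟨$⟩ʳ x)) (λ x → toℕ x <? m ×-dec m ≤? toℕ (τ ⟨$⟩ʳ x))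
  (λ {x} (x<m , m≤σx) → x<m , subst (λ y → m ≤ toℕ y) (σ≈τ x) m≤σx)
  (λ {x} (x<m , m≤τx) → x<m , subst (λ y → m ≤ toℕ y) (sym (σ≈τ x)) m≤τx)

-- Pointwise equal permutations need not be propositionally equal, so `cong` does not apply. The
-- first exponents transfer by `nest-cong`, the second ones through the heights.
ηStep-cong : ∀ {n} {σ τ : Permutation′ n} → σ ≈ τ → ∀ i → ηStep σ i ≡ ηStep τ i
ηStep-cong {σ = σ} {τ} σ≈τ i with kind σ i
... | κ , hσ@(im , pre) = trans (ηStep-kind σ κ hσ) (trans
  (cong₂ (step κ) (proj₁ agree) (proj₂ agree)) (sym (ηStep-kind τ κ hτ)))
  where
  hτ : HasKind τ i κ
  hτ = subst (OnSide (image κ) i) (σ≈τ i) im ,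
       subst (OnSide (preimage κ) i) (sym (⟨$⟩ˡ-unique τ (trans (sym (σ≈τ _)) (inverseʳ σ)))) pre
  nest≡ : ∀ κ → image κ ≢ equal → major κ σ i ≡ major κ τ i
  nest≡ opener     _ = Exc.nest-cong {σ = σ} {τ} (λ _ → σ≈τ _) (λ _ → σ≈τ _) i
  nest≡ linkedExc  _ = Exc.nest-cong {σ = σ} {τ} (λ _ → σ≈τ _) (λ _ → σ≈τ _) i
  nest≡ linkedAexc _ = Aexc.nest-cong {σ = σ} {τ} (λ _ → σ≈τ _) (λ _ → σ≈τ _) i
  nest≡ closer     _ = Aexc.nest-cong {σ = σ} {τ} (λ _ → σ≈τ _) (λ _ → σ≈τ _) i
  nest≡ fixed notFixed = contradiction refl notFixed
  agree = valid-agree (valid σ κ hσ)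
    (subst₂ (λ k k′ → Valid κ k k′ (major κ τ i) (minor κ τ i))
      (sym (height-cong {σ = σ} {τ} σ≈τ (toℕ i))) (sym (height-cong {σ = σ} {τ} σ≈τ (suc (toℕ i)))) (valid τ κ hτ))
    (nest≡ κ)

-- A permutation with the kinds of a given path

kinds : ∀ {k m} {M : Vec LabeledStep m} → Coded k M → Fin m → Kind
kinds (_∷_ {κ = κ} _ C) zero    = κ
kinds (_ ∷ C)           (suc j) = kinds C j

majors minors : ∀ {k m} {M : Vec LabeledStep m} → Coded k M → Fin m → ℕ
majors (_∷_ {x = x} _ C) zero    = x
majors (_ ∷ C)           (suc j) = majors C j
minors (_∷_ {y = y} _ C) zero    = y
minors (_ ∷ C)           (suc j) = minors C j

lookup-coded : ∀ {k m} {M : Vec LabeledStep m} (C : Coded k M) j →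
  lookup M j ≡ step (kinds C j) (majors C j) (minors C j)
lookup-coded (_ ∷ C) zero    = refl
lookup-coded (_ ∷ C) (suc j) = lookup-coded C j

-- The kinds determine the heights. So a permutation with the kinds of a path has the heights of
-- that path, and its exponents and those of the path obey the same constraints even where they
-- differ.
follow : ∀ {n} (σ : Permutation′ n) {k m} {M : Vec LabeledStep m} (C : Coded k M)
  i (pos : Fin m → Fin n) → (∀ j → toℕ (pos j) ≡ i + toℕ j) →
  (∀ j → HasKind σ (pos j) (kinds C j)) → height σ i ≡ k → ∀ j → ∃[ k ] ∃[ k′ ]
    Valid (kinds C j) k k′ (majors C j) (minors C j) ×
    Valid (kinds C j) k k′ (major (kinds C j) σ (pos j)) (minor (kinds C j) σ (pos j))
follow σ (_∷_ {κ} {k} {k′} {x} {y} v C) i pos pos≡ hasKind height≡k = λ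
  { zero    → k , k′ , v , subst (λ k′ → Valid κ k k′ _ _) height′≡k′ valid-zero
  ; (suc j) → follow σ C (suc i) (pos ∘ suc) (λ j → trans (pos≡ (suc j)) (ℕ.+-suc i (toℕ j)))
                (hasKind ∘ suc) (trans (cong (height σ ∘ suc) (sym pos-zero)) height′≡k′) j }
  where
  pos-zero : toℕ (pos zero) ≡ i
  pos-zero = trans (pos≡ zero) (ℕ.+-identityʳ i)
  valid-zero : Valid κ k (height σ (suc (toℕ (pos zero)))) (major κ σ (pos zero)) (minor κ σ (pos zero))
  valid-zero = subst (λ k → Valid κ k _ _ _) (trans (cong (height σ) pos-zero) height≡k)
    (valid σ κ (hasKind zero))
  height′≡k′ : height σ (suc (toℕ (pos zero))) ≡ k′
  height′≡k′ = valid-functional valid-zero v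

-- This relates a stage of the construction to its final outcome `σ` and not to the next stage: the
-- image of a stacked position becomes known only later, so the kind of a step can be verified only
-- backwards from the end.
record Extends {n} (i : ℕ) (π : Permutation′ n) {k} (L : Vec (Fin n) k) (σ : Permutation′ n) : Set where
  field
    settled : ∀ {x} → toℕ x < i → x ∉ L → σ ⟨$⟩ʳ x ≡ π ⟨$⟩ʳ x
    pending : ∀ {x} → x ∈ L → i ≤ toℕ (σ ⟨$⟩ʳ x)

  -- Before `i` no position can take `y` in `σ`: the stacked ones have images at least `i`, and a
  -- settled one would be the preimage of `y` under `π`, which is stacked.
  pendingˡ : ∀ {y} → toℕ y < i → (π ⟨$⟩ˡ y) ∈ L → i ≤ toℕ (σ ⟨$⟩ˡ y)
  pendingˡ {y} y<i π⁻¹y∈L with i ≤? toℕ (σ ⟨$⟩ˡ y)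
  ... | yes i≤σ⁻¹y = i≤σ⁻¹y
  ... | no  i≰σ⁻¹y with DecMembership._∈?_ Fin._≟_ (σ ⟨$⟩ˡ y) L
  ...   | yes σ⁻¹y∈L = contradiction (subst (λ z → i ≤ toℕ z) (inverseʳ σ) (pending σ⁻¹y∈L)) (ℕ.<⇒≱ y<i)
  ...   | no  σ⁻¹y∉L = contradiction
    (subst (_∈ L) (⟨$⟩ˡ-unique π (trans (sym (settled (ℕ.≰⇒> i≰σ⁻¹y) σ⁻¹y∉L)) (inverseʳ σ))) π⁻¹y∈L) σ⁻¹y∉L

open Extends

module Advance {n} (π : Permutation′ n) (q : Fin n)
  (π-fixes : ∀ {x} → q Fin.≤ x → π ⟨$⟩ʳ x ≡ x) where

  -- The stacked position `x` receives the image `q`, and `q` inherits the value on which `x` was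
  -- parked. At a closer both images are final. At a linked excedance `q` replaces `x` on the stack;
  -- at a linked anti-excedance `x` stays there, with `q` as the value now waiting.
  relink : Fin n → Permutation′ n
  relink x = transpose x q ∘ₚ π

  relink-≢ : ∀ {x z} → z ≢ x → z ≢ q → relink x ⟨$⟩ʳ z ≡ π ⟨$⟩ʳ z
  relink-≢ z≢x z≢q = cong (π ⟨$⟩ʳ_) (transpose-≢ z≢x z≢q)

  relink-x : ∀ x → relink x ⟨$⟩ʳ x ≡ q
  relink-x x = trans (cong (π ⟨$⟩ʳ_) (transpose-ˡ x q)) (π-fixes ℕ.≤-refl)

  relink-q : ∀ x → relink x ⟨$⟩ʳ q ≡ π ⟨$⟩ʳ x
  relink-q x = cong (π ⟨$⟩ʳ_) (transpose-ʳ x q)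

  relink-fixes : ∀ {x} → x Fin.< q → ∀ {z} → q Fin.< z → relink x ⟨$⟩ʳ z ≡ z
  relink-fixes x<q q<z = trans
    (relink-≢ (λ { refl → Fin.<-asym x<q q<z }) (λ { refl → Fin.<-irrefl refl q<z }))
    (π-fixes (ℕ.<⇒≤ q<z))

  -- A value from `q` on is its own preimage, so no smaller position can reach it.
  π-below : ∀ {x} → x Fin.< q → (π ⟨$⟩ʳ x) Fin.< q
  π-below {x} x<q = ℕ.≰⇒> λ q≤πx → ℕ.<⇒≱ x<q (subst (λ z → toℕ q ≤ toℕ z)
    (trans (sym (inverseˡ π)) (trans (cong (π ⟨$⟩ˡ_) (π-fixes q≤πx)) (inverseˡ π))) q≤πx)

  q<1+q : toℕ q < suc (toℕ q)
  q<1+q = ℕ.≤-refl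

  module _ {k} {L : Vec (Fin n) k} {σ : Permutation′ n} (L<q : ∀ {x} → x ∈ L → x Fin.< q) where

    q∉L : q ∉ L
    q∉L q∈L = Fin.<-irrefl refl (L<q q∈L)

    advance-opener : Extends (suc (toℕ q)) π (q ∷ L) σ → HasKind σ q opener × Extends (toℕ q) π L σ
    advance-opener E = (pending E (here refl) , pendingˡ E q<1+q
        (subst (_∈ q ∷ L) (sym (⟨$⟩ˡ-unique π (π-fixes ℕ.≤-refl))) (here refl))) , record
      { settled = λ x<q x∉L → settled E (ℕ.m<n⇒m<1+n x<q)
          λ { (here refl) → Fin.<-irrefl refl x<q ; (there x∈L) → x∉L x∈L }
      ; pending = λ x∈L → ℕ.<⇒≤ (pending E (there x∈L)) }

    advance-fixed : Extends (suc (toℕ q)) π L σ → HasKind σ q fixed × Extends (toℕ q) π L σ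
    advance-fixed E = (sym σq≡q , sym (⟨$⟩ˡ-unique σ σq≡q)) , record
      { settled = λ x<q → settled E (ℕ.m<n⇒m<1+n x<q)
      ; pending = λ x∈L → ℕ.<⇒≤ (pending E x∈L) }
      where
      σq≡q : σ ⟨$⟩ʳ q ≡ q
      σq≡q = trans (settled E q<1+q q∉L) (π-fixes ℕ.≤-refl)

  module _ {k} {x : Fin n} {L : Vec (Fin n) k} {σ : Permutation′ n}
    (L<q : ∀ {z} → z ∈ x ∷ L → z Fin.< q) (x∉L : x ∉ L) where

    private
      x<q = L<q (here refl)
      x≢q : x ≢ q
      x≢q refl = Fin.<-irrefl refl x<q

      unsettled : ∀ {j} {L′ : Vec (Fin n) j} → Extends (suc (toℕ q)) (relink x) L′ σ →
        (∀ {z} → z ∈ L′ → z ≡ q ⊎ z ∈ x ∷ L) → ∀ {z} → z Fin.< q → z ∉ x ∷ L →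
        σ ⟨$⟩ʳ z ≡ π ⟨$⟩ʳ z
      unsettled E L′⊆ {z} z<q z∉ = trans
        (settled E (ℕ.m<n⇒m<1+n z<q) λ z∈L′ → avoid (L′⊆ z∈L′))
        (relink-≢ (λ z≡x → z∉ (here z≡x)) z≢q)
        where
        z≢q : z ≢ q
        z≢q refl = Fin.<-irrefl refl z<q
        avoid : ¬ (z ≡ q ⊎ z ∈ x ∷ L)
        avoid (inj₁ z≡q) = z≢q z≡q
        avoid (inj₂ z∈)  = z∉ z∈

    advance-closer : Extends (suc (toℕ q)) (relink x) L σ → HasKind σ q closer × Extends (toℕ q) π (x ∷ L) σ
    advance-closer E = (subst (Fin._< q) (sym σq≡πx) (π-below x<q) ,
        subst (Fin._< q) (sym (⟨$⟩ˡ-unique σ σx≡q)) x<q) , record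
      { settled = unsettled E (inj₂ ∘ there)
      ; pending = λ { (here refl) → ℕ.≤-reflexive (cong toℕ (sym σx≡q))
                    ; (there z∈L) → ℕ.<⇒≤ (pending E z∈L) } }
      where
      σx≡q : σ ⟨$⟩ʳ x ≡ q
      σx≡q = trans (settled E (ℕ.m<n⇒m<1+n x<q) x∉L) (relink-x x)
      σq≡πx : σ ⟨$⟩ʳ q ≡ π ⟨$⟩ʳ x
      σq≡πx = trans (settled E q<1+q (q∉L {σ = σ} (L<q ∘ there))) (relink-q x)

    advance-linkedExc : Extends (suc (toℕ q)) (relink x) (q ∷ L) σ →
      HasKind σ q linkedExc × Extends (toℕ q) π (x ∷ L) σ
    advance-linkedExc E = (pending E (here refl) , subst (Fin._< q) (sym (⟨$⟩ˡ-unique σ σx≡q)) x<q) , record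
      { settled = unsettled E λ { (here z≡q) → inj₁ z≡q ; (there z∈L) → inj₂ (there z∈L) }
      ; pending = λ { (here refl) → ℕ.≤-reflexive (cong toℕ (sym σx≡q))
                    ; (there z∈L) → ℕ.<⇒≤ (pending E (there z∈L)) } }
      where
      σx≡q : σ ⟨$⟩ʳ x ≡ q
      σx≡q = trans
        (settled E (ℕ.m<n⇒m<1+n x<q) λ { (here x≡q) → x≢q x≡q ; (there x∈L) → x∉L x∈L })
        (relink-x x)

    advance-linkedAexc : Extends (suc (toℕ q)) (relink x) (x ∷ L) σ →
      HasKind σ q linkedAexc × Extends (toℕ q) π (x ∷ L) σ
    advance-linkedAexc E = (subst (Fin._< q) (sym σq≡πx) (π-below x<q) ,
        pendingˡ E q<1+q (subst (_∈ x ∷ L) (sym (⟨$⟩ˡ-unique (relink x) (relink-x x))) (here refl))) , record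
      { settled = unsettled E inj₂
      ; pending = λ z∈ → ℕ.<⇒≤ (pending E z∈) }
      where
      σq≡πx : σ ⟨$⟩ʳ q ≡ π ⟨$⟩ʳ x
      σq≡πx = trans (settled E q<1+q (q∉L {σ = σ} L<q)) (relink-q x)

  private
    fresh : ∀ {k} {L : Vec (Fin n) k} → (∀ {z} → z ∈ L → z Fin.< q) → VecAll.All (q ≢_) L
    fresh {L = []}    _   = []
    fresh {L = x ∷ L} L<q = (λ { refl → Fin.<-irrefl refl (L<q (here refl)) }) ∷ fresh (L<q ∘ there)

    below-q : ∀ {k} {L : Vec (Fin n) k} → (∀ {z} → z ∈ L → z Fin.< q) →
      ∀ {z} → z ∈ q ∷ L → toℕ z < suc (toℕ q)
    below-q L<q (here refl)  = q<1+q
    below-q L<q (there z∈L) = ℕ.m<n⇒m<1+n (L<q z∈L)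

  advance : ∀ {κ k k′ x y} → Valid κ k k′ x y → (L : Vec (Fin n) k) → Unique L →
    (∀ {z} → z ∈ L → z Fin.< q) →
    Σ[ π′ ∈ Permutation′ n ] Σ[ L′ ∈ Vec (Fin n) k′ ]
      Unique L′ × (∀ {z} → z ∈ L′ → toℕ z < suc (toℕ q)) × (∀ {z} → q Fin.< z → π′ ⟨$⟩ʳ z ≡ z) ×
      (∀ {σ} → Extends (suc (toℕ q)) π′ L′ σ → HasKind σ q κ × Extends (toℕ q) π L σ)
  advance (opener _) L unique L<q = π , q ∷ L ,
    (fresh L<q ∷ unique) , below-q L<q , (λ q<z → π-fixes (ℕ.<⇒≤ q<z)) , advance-opener L<q
  -- Linked steps and closers start at positive height, so the stack, whose length is the height,
  -- has a top element.
  advance (linkedExc _) (x ∷ L) (x≢L ∷ unique) L<q = relink x , q ∷ L ,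
    (fresh (L<q ∘ there) ∷ unique) , below-q (L<q ∘ there) , relink-fixes (L<q (here refl)) ,
    advance-linkedExc L<q (λ x∈L → VecAll.lookup x≢L x∈L refl)
  advance (linkedAexc _) (x ∷ L) unique@(x≢L ∷ _) L<q = relink x , x ∷ L ,
    unique , (λ z∈ → ℕ.m<n⇒m<1+n (L<q z∈)) , relink-fixes (L<q (here refl)) ,
    advance-linkedAexc L<q (λ x∈L → VecAll.lookup x≢L x∈L refl)
  advance (closer _) (x ∷ L) (x≢L ∷ unique) L<q = relink x , L ,
    unique , (λ z∈ → ℕ.m<n⇒m<1+n (L<q (there z∈))) , relink-fixes (L<q (here refl)) ,
    advance-closer L<q (λ x∈L → VecAll.lookup x≢L x∈L refl)
  advance (fixed _) L unique L<q = π , L ,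
    unique , (λ z∈ → ℕ.m<n⇒m<1+n (L<q z∈)) , (λ q<z → π-fixes (ℕ.<⇒≤ q<z)) , advance-fixed L<q

-- L is a stack of the positions whose image is still open; in the meantime
-- π sends them to the values that still wait for a preimage.
realize : ∀ {n k m} {M : Vec LabeledStep m} (C : Coded k M) i (pos : Fin m → Fin n) →
  (∀ j → toℕ (pos j) ≡ i + toℕ j) →
  (π : Permutation′ n) (L : Vec (Fin n) k) → Unique L → (∀ {x} → x ∈ L → toℕ x < i) →
  (∀ {x} → i ≤ toℕ x → π ⟨$⟩ʳ x ≡ x) →
  Σ[ σ ∈ Permutation′ n ] (∀ j → HasKind σ (pos j) (kinds C j)) × Extends i π L σ
realize [] i pos pos≡ π [] uniq L<i π-fixes =
  π , (λ ()) , record { settled = λ _ _ → refl ; pending = λ () }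
realize (v ∷ C) i pos pos≡ π L unique L<i π-fixes
  with refl ← trans (pos≡ zero) (ℕ.+-identityʳ i)
  with π′ , L′ , unique′ , L′<1+i , π′-fixes , retreat ← Advance.advance π (pos zero) π-fixes v L unique L<i
  with σ , hasKind , E ← realize C (suc i) (pos ∘ suc) (λ j → trans (pos≡ (suc j)) (ℕ.+-suc i (toℕ j)))
                           π′ L′ unique′ L′<1+i π′-fixes
  = σ , (λ { zero → proj₁ (retreat E) ; (suc j) → hasKind j }) , proj₂ (retreat E)

-- Surjectivity

-- The prescribed exponent is at most the common sum of exponents at this height, which is one less
-- than the number of available values. This is the bound that `prescribe` asks for.
bound-below : ∀ {n} (σ : Permutation′ n) {i} κ {k k′ x y} → HasKind σ i κ → (σ ⟨$⟩ʳ i) Fin.< i →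
  Valid κ k k′ x y → Valid κ k k′ (major κ σ i) (minor κ σ i) → x < count (Aexc.available? σ i)
bound-below σ {i} κ {x = x} (im , _) σi<i v v′ = subst (x <_)
  (sym (trans (Aexc.count-available-descent σ σi<i) (cong suc (Aexc.nest+cross σ σi<i))))
  (ℕ.s≤s (sum≡ κ (onSide-unique (image κ) below im σi<i) v v′))
  where
  sum≡ : ∀ κ {k k′ x y} → image κ ≡ below → Valid κ k k′ x y →
    Valid κ k k′ (major κ σ i) (minor κ σ i) → x ≤ Aexc.nest σ i + Aexc.cross σ i
  sum≡ linkedAexc _ = valid-≤ (λ ())
  sum≡ closer     _ = valid-≤ (λ ())

bound-above : ∀ {n} (σ : Permutation′ n) {i} κ {k k′ x y} → HasKind σ i κ → i Fin.< (σ ⟨$⟩ʳ i) →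
  Valid κ k k′ x y → Valid κ k k′ (major κ σ i) (minor κ σ i) → x < count (Exc.available? σ i)
bound-above σ {i} κ {x = x} (im , _) i<σi v v′ = subst (x <_)
  (sym (trans (Exc.count-available-descent σ i<σi) (cong suc (Exc.nest+cross σ i<σi))))
  (ℕ.s≤s (sum≡ κ (onSide-unique (image κ) above im i<σi) v v′))
  where
  sum≡ : ∀ κ {k k′ x y} → image κ ≡ above → Valid κ k k′ x y →
    Valid κ k k′ (major κ σ i) (minor κ σ i) → x ≤ Exc.nest σ i + Exc.cross σ i
  sum≡ opener    _ = valid-≤ (λ ())
  sum≡ linkedExc _ = valid-≤ (λ ())

-- Since the kinds survive a pass, so do the heights, and the bounds for the next pass can be
-- derived afresh for the rearranged permutation.
hasKind-aexc : ∀ {n} {π σ : Permutation′ n} → Aexc.Rearrangement π σ →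
  ∀ {i} κ → HasKind π i κ → HasKind σ i κ
hasKind-aexc {π = π} {σ} π→σ {i} κ (im , pre) = onImage (image κ) im , onPreimage κ im pre
  where
  open Aexc.Rearrangement π→σ
  onImage : ∀ o → OnSide o i (π ⟨$⟩ʳ i) → OnSide o i (σ ⟨$⟩ʳ i)
  onImage below = keeps
  onImage above = ascent
  onImage equal i≡πi = trans i≡πi (sym (fixes (Fin.<-irrefl (sym i≡πi))))
  onPreimage : ∀ κ → OnSide (image κ) i (π ⟨$⟩ʳ i) → OnSide (preimage κ) i (π ⟨$⟩ˡ i) →
    OnSide (preimage κ) i (σ ⟨$⟩ˡ i)
  onPreimage opener     _ = ascentˡ
  onPreimage linkedExc  _ = descentˡ
  onPreimage linkedAexc _ = ascentˡ
  onPreimage closer     _ = descentˡ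
  onPreimage fixed i≡πi _ = sym (⟨$⟩ˡ-unique σ (sym (onImage equal i≡πi)))

hasKind-exc : ∀ {n} {π σ : Permutation′ n} → Exc.Rearrangement π σ →
  ∀ {i} κ → HasKind π i κ → HasKind σ i κ
hasKind-exc {π = π} {σ} π→σ {i} κ (im , pre) = onImage (image κ) im , onPreimage κ im pre
  where
  open Exc.Rearrangement π→σ
  onImage : ∀ o → OnSide o i (π ⟨$⟩ʳ i) → OnSide o i (σ ⟨$⟩ʳ i)
  onImage below = ascent
  onImage above = keeps
  onImage equal i≡πi = trans i≡πi (sym (fixes (Fin.<-irrefl i≡πi)))
  onPreimage : ∀ κ → OnSide (image κ) i (π ⟨$⟩ʳ i) → OnSide (preimage κ) i (π ⟨$⟩ˡ i) →
    OnSide (preimage κ) i (σ ⟨$⟩ˡ i)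
  onPreimage opener     _ = descentˡ
  onPreimage linkedExc  _ = ascentˡ
  onPreimage linkedAexc _ = descentˡ
  onPreimage closer     _ = ascentˡ
  onPreimage fixed i≡πi _ = sym (⟨$⟩ˡ-unique σ (sym (onImage equal i≡πi)))

increasing decreasing : ∀ n → List.List (Fin n)
increasing n = List.allFin n
decreasing n = List.tabulate opposite

opposite-< : ∀ {n} {i j : Fin n} → i Fin.< j → opposite j Fin.< opposite i
opposite-< {n} {i} {j} i<j = subst₂ _<_ (sym (Fin.opposite-prop j)) (sym (Fin.opposite-prop i))
  (ℕ.∸-monoʳ-< (ℕ.s≤s i<j) (Fin.toℕ<n j))

∈-decreasing : ∀ {n} (i : Fin n) → i List.∈ decreasing n
∈-decreasing {n} i = subst (List._∈ decreasing n) (Fin.opposite-involutive i) (∈-tabulate⁺ {f = opposite} (opposite i))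

ηSteps-surjective : ∀ {n} {M : Vec LabeledStep n} → Coded 0 M → ∃[ σ ] ηSteps σ ≡ M
ηSteps-surjective {n} {M} C
  with π , kinds-π , _ ← realize C 0 id (λ _ → refl) idₚ [] [] (λ ()) (λ _ → refl)
  with track ← follow π C 0 id (λ _ → refl) kinds-π (height-0 π)
  with σ , π→σ , _ , nest-σ ← Aexc.prescribe (majors C) (increasing n) (ListAllPairs.tabulate⁺-< id) π
         (λ {i} _ πi<i → let _ , _ , v , v′ = track i in bound-below π (kinds C i) (kinds-π i) πi<i v v′)
  with kinds-σ ← (λ i → hasKind-aexc π→σ (kinds C i) (kinds-π i))
  with track′ ← follow σ C 0 id (λ _ → refl) kinds-σ (height-0 σ)
  with τ , σ→τ , _ , nest-τ ← Exc.prescribe (majors C) (decreasing n) (ListAllPairs.tabulate⁺-< opposite-<) σ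
         (λ {i} _ i<σi → let _ , _ , v , v′ = track′ i in bound-above σ (kinds C i) (kinds-σ i) i<σi v v′)
  with kinds-τ ← (λ i → hasKind-exc σ→τ (kinds C i) (kinds-σ i))
  with track″ ← follow τ C 0 id (λ _ → refl) kinds-τ (height-0 τ)
  = τ , trans (Vec.tabulate-cong steps) (Vec.tabulate∘lookup M)
  where
  steps : ∀ i → ηStep τ i ≡ lookup M i
  steps i = trans (ηStep-kind τ κ (kinds-τ i)) (trans
    (cong₂ (step κ) (proj₁ agree) (proj₂ agree)) (sym (lookup-coded C i)))
    where
    κ = kinds C i
    -- An anti-excedance of `τ` is not an excedance of `σ`, so the second pass has left its image
    -- alone.
    onAexc : ∀ {x} → (τ ⟨$⟩ʳ x) Fin.< x → τ ⟨$⟩ʳ x ≡ σ ⟨$⟩ʳ x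
    onAexc τx<x = Exc.Rearrangement.fixes σ→τ
      λ x<σx → Fin.<-asym τx<x (Exc.Rearrangement.keeps σ→τ x<σx)
    major≡ : ∀ o → image κ ≡ o → o ≢ equal → major κ τ i ≡ majors C i
    major≡ below image≡ _ = begin
      major κ τ i  ≡⟨ major-below κ image≡ τ i ⟩
      Aexc.nest τ i ≡⟨ Aexc.nest-cong {σ = τ} {σ} onAexc (λ σx<x → Exc.Rearrangement.fixes σ→τ (Fin.<-asym σx<x)) i ⟩
      Aexc.nest σ i ≡⟨ nest-σ (∈-allFin i) (subst (λ o → OnSide o i (π ⟨$⟩ʳ i)) image≡ (proj₁ (kinds-π i))) ⟩
      majors C i   ∎
      where open ≡-Reasoning
    major≡ above image≡ _ = trans (major-above κ image≡ τ i)
      (nest-τ (∈-decreasing i) (subst (λ o → OnSide o i (σ ⟨$⟩ʳ i)) image≡ (proj₁ (kinds-σ i))))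
    major≡ equal _ notFixed = contradiction refl notFixed
    agree : major κ τ i ≡ majors C i × minor κ τ i ≡ minors C i
    -- The passes prescribe first exponents only; the heights supply the second ones and the
    -- exponents of the fixed points.
    agree with _ , _ , v , v′ ← track″ i = valid-agree v′ v (major≡ (image κ) refl)

-- The weight

-- The subtracted sum is a part of `sum e`, so the truncated difference is a true one.
sum-if-not : ∀ {n} (β : Fin n → Bool) (e : Fin n → ℕ) →
  sum e ∸ sum (λ i → if β i then e i else 0) ≡ sum (λ i → if β i then 0 else e i)
sum-if-not β e = begin
  sum e ∸ sum yes′                ≡⟨ cong (_∸ sum yes′) (trans (sum-cong-≗ split) (∑-distrib-+ yes′ no′)) ⟩
  sum yes′ + sum no′ ∸ sum yes′   ≡⟨ ℕ.m+n∸m≡n (sum yes′) (sum no′) ⟩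
  sum no′                         ∎
  where
  open ≡-Reasoning
  yes′ = λ i → if β i then e i else 0
  no′  = λ i → if β i then 0 else e i
  split : ∀ i → e i ≡ yes′ i + no′ i
  split i with β i
  ... | true  = sym (ℕ.+-identityʳ (e i))
  ... | false = refl

-- The exponents are stored by indeterminate and not by step, so that each coordinate of the product
-- is a sum to be matched with one statistic.
product-tabulate : ∀ {n} (F : Fin n → LabeledStep) (E : Vec (Fin n → ℕ) 14) →
  (∀ i → proj₂ (F i) ≡ Vec.map (λ e → e i) E) →
  Vec.foldr′ _·_ ε (Vec.map proj₂ (tabulate F)) ≡ Vec.map sum E
product-tabulate {zero} F E _ = zeros E
  where
  zeros : ∀ {k} (E : Vec (Fin 0 → ℕ) k) → Vec.replicate k 0 ≡ Vec.map sum E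
  zeros []      = refl
  zeros (e ∷ E) = cong (0 ∷_) (zeros E)
product-tabulate {suc n} F E F≡E = begin
  proj₂ (F zero) · Vec.foldr′ _·_ ε (Vec.map proj₂ (tabulate (F ∘ suc)))
    ≡⟨ cong₂ _·_ (F≡E zero) (product-tabulate (F ∘ suc) (Vec.map (_∘ suc) E)
         λ i → trans (F≡E (suc i)) (Vec.map-∘ (λ e → e i) (_∘ suc) E)) ⟩
  Vec.map (λ e → e zero) E · Vec.map sum (Vec.map (_∘ suc) E)
    ≡⟨ heads E ⟩
  Vec.map sum E ∎
  where
  open ≡-Reasoning
  heads : ∀ {k} (E : Vec (Fin (suc n) → ℕ) k) →
    Vec.zipWith _+_ (Vec.map (λ e → e zero) E) (Vec.map sum (Vec.map (_∘ suc) E)) ≡ Vec.map sum E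
  heads []      = refl
  heads (e ∷ E) = cong (sum e ∷_) (heads E)

+0ⁿ : ∀ k x → fold x (_+ 0) k ≡ x
+0ⁿ zero    x = refl
+0ⁿ (suc k) x = trans (ℕ.+-identityʳ _) (+0ⁿ k x)

infixr 5 _∷≡_

_∷≡_ : ∀ {k x y} {X Y : Vec ℕ k} → x ≡ y → X ≡ Y → x ∷ X ≡ y ∷ Y
_∷≡_ = cong₂ _∷_

normalForm : ∀ x₀ x₁ x₂ x₃ x₄ x₅ x₆ x₇ x₈ x₉ x₁₀ x₁₁ x₁₂ x₁₃ →
  a ^ x₀ · b ^ x₁ · c ^ x₂ · d ^ x₃ · f ^ x₄ · g ^ x₅ · h ^ x₆ · ℓ ^ x₇
    · p ^ x₈ · r ^ x₉ · s ^ x₁₀ · t ^ x₁₁ · u ^ x₁₂ · w ^ x₁₃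
  ≡ x₀ ∷ x₁ ∷ x₂ ∷ x₃ ∷ x₄ ∷ x₅ ∷ x₆ ∷ x₇ ∷ x₈ ∷ x₉ ∷ x₁₀ ∷ x₁₁ ∷ x₁₂ ∷ x₁₃ ∷ []
normalForm x₀ x₁ x₂ x₃ x₄ x₅ x₆ x₇ x₈ x₉ x₁₀ x₁₁ x₁₂ x₁₃
  rewrite ℕ.*-zeroʳ x₀ | ℕ.*-zeroʳ x₁ | ℕ.*-zeroʳ x₂ | ℕ.*-zeroʳ x₃ | ℕ.*-zeroʳ x₄
        | ℕ.*-zeroʳ x₅ | ℕ.*-zeroʳ x₆ | ℕ.*-zeroʳ x₇ | ℕ.*-zeroʳ x₈ | ℕ.*-zeroʳ x₉
        | ℕ.*-zeroʳ x₁₀ | ℕ.*-zeroʳ x₁₁ | ℕ.*-zeroʳ x₁₂ | ℕ.*-zeroʳ x₁₃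
        | ℕ.*-identityʳ x₀ | ℕ.*-identityʳ x₁ | ℕ.*-identityʳ x₂ | ℕ.*-identityʳ x₃
        | ℕ.*-identityʳ x₄ | ℕ.*-identityʳ x₅ | ℕ.*-identityʳ x₆ | ℕ.*-identityʳ x₇
        | ℕ.*-identityʳ x₈ | ℕ.*-identityʳ x₉ | ℕ.*-identityʳ x₁₀ | ℕ.*-identityʳ x₁₁
        | ℕ.*-identityʳ x₁₂ | ℕ.*-identityʳ x₁₃ =
  -- Each number counts the factors to the right of the given power, which leave that many trailing
  -- `+ 0`; the zeros from the left compute away.
  +0ⁿ 13 x₀ ∷≡ +0ⁿ 12 x₁ ∷≡ +0ⁿ 11 x₂ ∷≡ +0ⁿ 10 x₃ ∷≡ +0ⁿ 9 x₄ ∷≡ +0ⁿ 8 x₅ ∷≡ +0ⁿ 7 x₆ ∷≡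
  +0ⁿ 6 x₇ ∷≡ +0ⁿ 5 x₈ ∷≡ +0ⁿ 4 x₉ ∷≡ +0ⁿ 3 x₁₀ ∷≡ +0ⁿ 2 x₁₁ ∷≡ +0ⁿ 1 x₁₂ ∷≡ refl

-- The flags `linkedˡ` and `linkedʳ` record only the side on which σ⁻¹(i) lies. Thus an opener has
-- `linkedʳ` true and a closer has `linkedˡ` true; the entries selected there are zero, because
-- anti-excedance statistics vanish at excedances and vice versa.
row : (linkedˡ linkedʳ exc? aexc? fixed? : Bool) (e e′ ē ē′ k : ℕ) → Vec ℕ 14
row linkedˡ linkedʳ exc? aexc? fixed? e e′ ē ē′ k =
  (if linkedˡ then e else 0) ∷ (if linkedˡ then e′ else 0) ∷
  (if linkedˡ then 0 else e) ∷ (if linkedˡ then 0 else e′) ∷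
  (if linkedʳ then ē else 0) ∷ (if linkedʳ then ē′ else 0) ∷
  (if linkedʳ then 0 else ē) ∷ (if linkedʳ then 0 else ē′) ∷
  (if linkedˡ then 0 else (if exc? then 1 else 0)) ∷
  (if linkedʳ then 0 else (if aexc? then 1 else 0)) ∷
  (if linkedˡ then (if exc? then 1 else 0) else 0) ∷
  (if linkedʳ then (if aexc? then 1 else 0) else 0) ∷
  (if fixed? then 1 else 0) ∷
  (if fixed? then k else 0) ∷ []

module _ (x y k : ℕ) where

  opener-row : c ^ x · d ^ y · p ≡ row false true true false false x y 0 0 k
  opener-row rewrite ℕ.*-identityʳ x | ℕ.*-zeroʳ x | ℕ.*-identityʳ y | ℕ.*-zeroʳ y =
    refl ∷≡ refl ∷≡ +0ⁿ 2 x ∷≡ +0ⁿ 1 y ∷≡ refl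

  linkedExc-row : a ^ x · b ^ y · s ≡ row true false true false false x y 0 0 k
  linkedExc-row rewrite ℕ.*-identityʳ x | ℕ.*-zeroʳ x | ℕ.*-identityʳ y | ℕ.*-zeroʳ y =
    +0ⁿ 2 x ∷≡ +0ⁿ 1 y ∷≡ refl

  linkedAexc-row : f ^ x · g ^ y · t ≡ row false true false true false 0 0 x y k
  linkedAexc-row rewrite ℕ.*-identityʳ x | ℕ.*-zeroʳ x | ℕ.*-identityʳ y | ℕ.*-zeroʳ y =
    refl ∷≡ refl ∷≡ refl ∷≡ refl ∷≡ +0ⁿ 2 x ∷≡ +0ⁿ 1 y ∷≡ refl

  closer-row : h ^ x · ℓ ^ y · r ≡ row true false false true false 0 0 x y k
  closer-row rewrite ℕ.*-identityʳ x | ℕ.*-zeroʳ x | ℕ.*-identityʳ y | ℕ.*-zeroʳ y =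
    refl ∷≡ refl ∷≡ refl ∷≡ refl ∷≡ refl ∷≡ refl ∷≡ +0ⁿ 2 x ∷≡ +0ⁿ 1 y ∷≡ refl

fixed-row : ∀ k → u · w ^ k ≡ row false false false false true 0 0 0 0 k
fixed-row k rewrite ℕ.*-identityʳ k | ℕ.*-zeroʳ k = refl

row-cong : ∀ {l l₁ m m₁ x x₁ y y₁ z z₁ e e₁ e′ e′₁ ē ē₁ ē′ ē′₁ k} →
  l ≡ l₁ → m ≡ m₁ → x ≡ x₁ → y ≡ y₁ → z ≡ z₁ → e ≡ e₁ → e′ ≡ e′₁ → ē ≡ ē₁ → ē′ ≡ ē′₁ →
  row l m x y z e e′ ē ē′ k ≡ row l₁ m₁ x₁ y₁ z₁ e₁ e′₁ ē₁ ē′₁ k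
row-cong refl refl refl refl refl refl refl refl refl = refl

module _ {n} (σ : Permutation′ n) where

  private
    linkedˡ? = λ i → (σ ⟨$⟩ˡ i) Fin.<? i
    linkedʳ? = λ i → i Fin.<? (σ ⟨$⟩ˡ i)
    exc?     = λ i → i Fin.<? (σ ⟨$⟩ʳ i)
    aexc?    = λ i → (σ ⟨$⟩ʳ i) Fin.<? i
    fixed?   = λ i → i Fin.≟ (σ ⟨$⟩ʳ i)

  exponents : Vec (Fin n → ℕ) 14
  exponents =
    (λ i → if does (linkedˡ? i) then inveᵢ σ i else 0) ∷
    (λ i → if does (linkedˡ? i) then ninveᵢ σ i else 0) ∷
    (λ i → if does (linkedˡ? i) then 0 else inveᵢ σ i) ∷
    (λ i → if does (linkedˡ? i) then 0 else ninveᵢ σ i) ∷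
    (λ i → if does (linkedʳ? i) then invaᵢ σ i else 0) ∷
    (λ i → if does (linkedʳ? i) then ninvaᵢ σ i else 0) ∷
    (λ i → if does (linkedʳ? i) then 0 else invaᵢ σ i) ∷
    (λ i → if does (linkedʳ? i) then 0 else ninvaᵢ σ i) ∷
    (λ i → if does (linkedˡ? i) then 0 else indicator (exc? i)) ∷
    (λ i → if does (linkedʳ? i) then 0 else indicator (aexc? i)) ∷
    (λ i → if does (linkedˡ? i) then indicator (exc? i) else 0) ∷
    (λ i → if does (linkedʳ? i) then indicator (aexc? i) else 0) ∷
    (λ i → indicator (fixed? i)) ∷
    (λ i → if does (fixed? i) then iefpᵢ σ i else 0) ∷ []

  exponents-kind : ∀ {i} κ → HasKind σ i κ →
    proj₂ (step κ (major κ σ i) (minor κ σ i)) ≡ Vec.map (λ e → e i) exponents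
  exponents-kind {i} opener (i<σi , i<σ⁻¹i) = trans
    (opener-row (inveᵢ σ i) (ninveᵢ σ i) (iefpᵢ σ i)) (sym (row-cong
      (dec-false (linkedˡ? i) (Fin.<-asym i<σ⁻¹i)) (dec-true (linkedʳ? i) i<σ⁻¹i)
      (dec-true (exc? i) i<σi) (dec-false (aexc? i) (Fin.<-asym i<σi))
      (dec-false (fixed? i) λ i≡σi → Fin.<-irrefl i≡σi i<σi)
      refl refl (Aexc.nest-∅ σ (Fin.<-asym i<σi)) (Aexc.cross-∅ σ (Fin.<-asym i<σi))))
  exponents-kind {i} linkedExc (i<σi , σ⁻¹i<i) = trans
    (linkedExc-row (inveᵢ σ i) (ninveᵢ σ i) (iefpᵢ σ i)) (sym (row-cong
      (dec-true (linkedˡ? i) σ⁻¹i<i) (dec-false (linkedʳ? i) (Fin.<-asym σ⁻¹i<i))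
      (dec-true (exc? i) i<σi) (dec-false (aexc? i) (Fin.<-asym i<σi))
      (dec-false (fixed? i) λ i≡σi → Fin.<-irrefl i≡σi i<σi)
      refl refl (Aexc.nest-∅ σ (Fin.<-asym i<σi)) (Aexc.cross-∅ σ (Fin.<-asym i<σi))))
  exponents-kind {i} linkedAexc (σi<i , i<σ⁻¹i) = trans
    (linkedAexc-row (invaᵢ σ i) (ninvaᵢ σ i) (iefpᵢ σ i)) (sym (row-cong
      (dec-false (linkedˡ? i) (Fin.<-asym i<σ⁻¹i)) (dec-true (linkedʳ? i) i<σ⁻¹i)
      (dec-false (exc? i) (Fin.<-asym σi<i)) (dec-true (aexc? i) σi<i)
      (dec-false (fixed? i) λ i≡σi → Fin.<-irrefl (sym i≡σi) σi<i)
      (Exc.nest-∅ σ (Fin.<-asym σi<i)) (Exc.cross-∅ σ (Fin.<-asym σi<i)) refl refl))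
  exponents-kind {i} closer (σi<i , σ⁻¹i<i) = trans
    (closer-row (invaᵢ σ i) (ninvaᵢ σ i) (iefpᵢ σ i)) (sym (row-cong
      (dec-true (linkedˡ? i) σ⁻¹i<i) (dec-false (linkedʳ? i) (Fin.<-asym σ⁻¹i<i))
      (dec-false (exc? i) (Fin.<-asym σi<i)) (dec-true (aexc? i) σi<i)
      (dec-false (fixed? i) λ i≡σi → Fin.<-irrefl (sym i≡σi) σi<i)
      (Exc.nest-∅ σ (Fin.<-asym σi<i)) (Exc.cross-∅ σ (Fin.<-asym σi<i)) refl refl))
  exponents-kind {i} fixed (i≡σi , i≡σ⁻¹i) = trans
    (fixed-row (iefpᵢ σ i)) (sym (row-cong
      (dec-false (linkedˡ? i) (Fin.<-irrefl (sym i≡σ⁻¹i))) (dec-false (linkedʳ? i) (Fin.<-irrefl i≡σ⁻¹i))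
      (dec-false (exc? i) (Fin.<-irrefl i≡σi)) (dec-false (aexc? i) (Fin.<-irrefl (sym i≡σi)))
      (dec-true (fixed? i) i≡σi)
      (Exc.nest-∅ σ (Fin.<-irrefl i≡σi)) (Exc.cross-∅ σ (Fin.<-irrefl i≡σi))
      (Aexc.nest-∅ σ (Fin.<-irrefl (sym i≡σi))) (Aexc.cross-∅ σ (Fin.<-irrefl (sym i≡σi)))))

  private
    linked-count : ∀ {A B : Fin n → Set} (A? : Decidable A) (B? : Decidable B) →
      count (λ i → A? i ×-dec B? i) ≡ sum (λ i → if does (A? i) then indicator (B? i) else 0)
    linked-count A? B? = trans (count≡sum (λ i → A? i ×-dec B? i)) (sum-cong-≗ λ i → pointwise (A? i) (B? i))
      where
      pointwise : ∀ {P Q : Set} (P? : Dec P) (Q? : Dec Q) →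
        indicator (P? ×-dec Q?) ≡ (if does P? then indicator Q? else 0)
      pointwise (yes _) _ = refl
      pointwise (no _)  _ = refl

    ile≡ : ile σ ≡ sum (λ j → if does (linkedˡ? j) then inveᵢ σ j else 0)
    ile≡ = trans (count₂≡sumᵒ (λ i j → Exc.nesting? σ j i ×-dec linkedˡ? j))
      (sum-cong-≗ λ j → count-×-const (Exc.nesting? σ j) (linkedˡ? j))

    nile≡ : nile σ ≡ sum (λ j → if does (linkedˡ? j) then ninveᵢ σ j else 0)
    nile≡ = trans (count₂≡sumᵒ (λ i j → Exc.crossing? σ j i ×-dec linkedˡ? j))
      (sum-cong-≗ λ j → count-×-const (Exc.crossing? σ j) (linkedˡ? j))

    ilae≡ : ilae σ ≡ sum (λ i → if does (linkedʳ? i) then invaᵢ σ i else 0)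
    ilae≡ = trans (count₂≡sum (λ i j → Aexc.nesting? σ i j ×-dec linkedʳ? i))
      (sum-cong-≗ λ i → count-×-const (Aexc.nesting? σ i) (linkedʳ? i))

    nilae≡ : nilae σ ≡ sum (λ i → if does (linkedʳ? i) then ninvaᵢ σ i else 0)
    nilae≡ = trans (count₂≡sum (λ i j → Aexc.crossing? σ i j ×-dec linkedʳ? i))
      (sum-cong-≗ λ i → count-×-const (Aexc.crossing? σ i) (linkedʳ? i))

    ie∸ile≡ : ie σ ∸ ile σ ≡ sum (λ j → if does (linkedˡ? j) then 0 else inveᵢ σ j)
    ie∸ile≡ = trans (cong₂ _∸_ (count₂≡sumᵒ (λ i j → Exc.nesting? σ j i)) ile≡)
      (sum-if-not (does ∘ linkedˡ?) (inveᵢ σ))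

    nie∸nile≡ : nie σ ∸ nile σ ≡ sum (λ j → if does (linkedˡ? j) then 0 else ninveᵢ σ j)
    nie∸nile≡ = trans (cong₂ _∸_ (count₂≡sumᵒ (λ i j → Exc.crossing? σ j i)) nile≡)
      (sum-if-not (does ∘ linkedˡ?) (ninveᵢ σ))

    iae∸ilae≡ : iae σ ∸ ilae σ ≡ sum (λ i → if does (linkedʳ? i) then 0 else invaᵢ σ i)
    iae∸ilae≡ = trans (cong₂ _∸_ (count₂≡sum (λ i j → Aexc.nesting? σ i j)) ilae≡)
      (sum-if-not (does ∘ linkedʳ?) (invaᵢ σ))

    niae∸nilae≡ : niae σ ∸ nilae σ ≡ sum (λ i → if does (linkedʳ? i) then 0 else ninvaᵢ σ i)
    niae∸nilae≡ = trans (cong₂ _∸_ (count₂≡sum (λ i j → Aexc.crossing? σ i j)) nilae≡)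
      (sum-if-not (does ∘ linkedʳ?) (ninvaᵢ σ))

    le≡ : le σ ≡ sum (λ i → if does (linkedˡ? i) then indicator (exc? i) else 0)
    le≡ = linked-count linkedˡ? exc?

    lae≡ : lae σ ≡ sum (λ i → if does (linkedʳ? i) then indicator (aexc? i) else 0)
    lae≡ = linked-count linkedʳ? aexc?

    exc∸le≡ : exc σ ∸ le σ ≡ sum (λ i → if does (linkedˡ? i) then 0 else indicator (exc? i))
    exc∸le≡ = trans (cong₂ _∸_ (count≡sum exc?) le≡) (sum-if-not (does ∘ linkedˡ?) (indicator ∘ exc?))

    aexc∸lae≡ : aexc σ ∸ lae σ ≡ sum (λ i → if does (linkedʳ? i) then 0 else indicator (aexc? i))
    aexc∸lae≡ = trans (cong₂ _∸_ (count≡sum aexc?) lae≡) (sum-if-not (does ∘ linkedʳ?) (indicator ∘ aexc?))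

    iefp≡ : iefp σ ≡ sum (λ j → if does (fixed? j) then iefpᵢ σ j else 0)
    iefp≡ = trans (count₂≡sumᵒ row?) (sum-cong-≗ λ j → trans
      -- At a fixed point `j` the condition σ(j) < σ(i) reads j < σ(i), which is the spanning
      -- condition of `iefpᵢ`.
      (count-cong (λ i → row? i j) (λ i → Exc.spanning? σ j i ×-dec fixed? j)
        (λ (i<j , j≡σj , σj<σi) → (i<j , subst (Fin._< _) (sym j≡σj) σj<σi) , j≡σj)
        (λ ((i<j , j<σi) , j≡σj) → i<j , j≡σj , subst (Fin._< _) j≡σj j<σi))
      (count-×-const (Exc.spanning? σ j) (fixed? j)))
      where
      row? = λ i j → i Fin.<? j ×-dec j Fin.≟ (σ ⟨$⟩ʳ j) ×-dec (σ ⟨$⟩ʳ j) Fin.<? (σ ⟨$⟩ʳ i)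

  weight : Vec.foldr′ _·_ ε (Vec.map proj₂ (ηSteps σ)) ≡
    a ^ ile σ · b ^ nile σ · c ^ (ie σ ∸ ile σ) · d ^ (nie σ ∸ nile σ)
      · f ^ ilae σ · g ^ nilae σ · h ^ (iae σ ∸ ilae σ) · ℓ ^ (niae σ ∸ nilae σ)
      · p ^ (exc σ ∸ le σ) · r ^ (aexc σ ∸ lae σ) · s ^ le σ · t ^ lae σ · u ^ fp σ · w ^ iefp σ
  weight = begin
    Vec.foldr′ _·_ ε (Vec.map proj₂ (ηSteps σ))
      ≡⟨ product-tabulate (ηStep σ) exponents (λ i → let κ , hasKind = kind σ i in
           trans (cong proj₂ (ηStep-kind σ κ hasKind)) (exponents-kind κ hasKind)) ⟩
    Vec.map sum exponents
      ≡⟨ ile≡ ∷≡ nile≡ ∷≡ ie∸ile≡ ∷≡ nie∸nile≡ ∷≡ ilae≡ ∷≡ nilae≡ ∷≡ iae∸ilae≡ ∷≡ niae∸nilae≡ ∷≡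
         exc∸le≡ ∷≡ aexc∸lae≡ ∷≡ le≡ ∷≡ lae≡ ∷≡ count≡sum fixed? ∷≡ iefp≡ ∷≡ refl ⟨
    ile σ ∷ nile σ ∷ ie σ ∸ ile σ ∷ nie σ ∸ nile σ ∷ ilae σ ∷ nilae σ ∷ iae σ ∸ ilae σ ∷ niae σ ∸ nilae σ ∷
      exc σ ∸ le σ ∷ aexc σ ∸ lae σ ∷ le σ ∷ lae σ ∷ fp σ ∷ iefp σ ∷ []
      ≡⟨ normalForm (ile σ) (nile σ) (ie σ ∸ ile σ) (nie σ ∸ nile σ) (ilae σ) (nilae σ)
           (iae σ ∸ ilae σ) (niae σ ∸ nilae σ) (exc σ ∸ le σ) (aexc σ ∸ lae σ) (le σ) (lae σ) (fp σ) (iefp σ) ⟨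
    _ ∎
    where open ≡-Reasoning

theorem3 : (n : ℕ) →
    Σ[ η∈ℳ ∈ (∀ (σ : Permutation′ n) → MotzkinFrom 0 (ηSteps σ)) ]
      (let η : Permutation′ n → ℳ n
           η σ = ηSteps σ , η∈ℳ σ
       in IsBijection _≈_ _≈ₘ_ η
          × (∀ (σ : Permutation′ n) →
              wt (η σ) ≡
                a ^ ile σ · b ^ nile σ
                · c ^ (ie σ ∸ ile σ) · d ^ (nie σ ∸ nile σ)
                · f ^ ilae σ · g ^ nilae σ
                · h ^ (iae σ ∸ ilae σ) · ℓ ^ (niae σ ∸ nilae σ)
                · p ^ (exc σ ∸ le σ) · r ^ (aexc σ ∸ lae σ)
                · s ^ le σ · t ^ lae σ · u ^ fp σ · w ^ iefp σ))
theorem3 n = coded⇒motzkin ∘ ηSteps-coded , record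
  { isInjection = record
    { isCongruent = record
      { cong           = λ {σ} {τ} σ≈τ → Vec.tabulate-cong (ηStep-cong {σ = σ} {τ} σ≈τ)
      ; isEquivalence₁ = record
        { refl = λ _ → refl ; sym = λ σ≈τ i → sym (σ≈τ i) ; trans = λ σ≈τ τ≈υ i → trans (σ≈τ i) (τ≈υ i) }
      ; isEquivalence₂ = record { refl = refl ; sym = sym ; trans = trans } }
    ; injective = λ {σ} {τ} ησ≡ητ → ηStep-injective {σ = σ} {τ} λ i → begin
        ηStep σ i           ≡⟨ Vec.lookup∘tabulate (ηStep σ) i ⟨
        lookup (ηSteps σ) i ≡⟨ cong (λ M → lookup M i) ησ≡ητ ⟩
        lookup (ηSteps τ) i ≡⟨ Vec.lookup∘tabulate (ηStep τ) i ⟩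
        ηStep τ i           ∎ }
  ; surjective = λ (_ , M∈ℳ) → let σ , ησ≡M = ηSteps-surjective (motzkin⇒coded M∈ℳ) in
      σ , λ {τ} τ≈σ → trans (Vec.tabulate-cong (ηStep-cong {σ = τ} {σ} τ≈σ)) ησ≡M } ,
  weight
  where open ≡-Reasoning
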